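{- Let $C'_{\mathrm{loop}} = \mathtt{while}(\varphi')\{C\}$ be a pGCL loop with looping time $T^{\neg\varphi'}$, and suppose that there exist $N\in\mathbb{N}$ and $p\in(0,1)$ such that $\mathbb{P}_\sigma(T^{\neg\varphi'}>N)\le p$ for every initial state $\sigma\in\Sigma$. Let $h\in\mathbb{E}$ be a finite expectation, i.e. $h(\sigma)<\infty$ for all $\sigma\in\Sigma$. If (i) $C'_{\mathrm{loop}}$ has the bounded update property, i.e., there exists $c\in\mathbb{R}_{\ge 0}$ such that for every $\sigma\in\Sigma$, $\mathbb{P}_\sigma(\forall n\in\mathbb{N}\colon |X_{n+1}-X_n|\le c)=1$, and (ii) $h$ is bounded by a polynomial expectation, i.e., there is a polynomial $q$ in the program variables that is an expectation (non-negative valued) with $h\preceq q$, then $h$ is uniformly integrable for $C'_{\mathrm{loop}}$.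
   Context: States and predicates: $\mathrm{Vars}$ is a countable set of program variables; a program state is a map $\sigma\colon \mathrm{Vars}\to\mathbb{R}$, and $\Sigma$ is the set of all program states (with the product Borel $\sigma$-algebra). A predicate $\varphi$ (a loop guard or branching condition) is identified with a measurable subset of $\Sigma$; $\sigma\models\varphi$ means $\sigma$ lies in that subset. The Iverson bracket $[\varphi]\colon\Sigma\to\{0,1\}$ is the indicator function of $\varphi$. pGCL programs: generated by the grammar $C ::= \mathtt{skip} \mid x:=e \mid x:\approx\mu \mid C;C \mid \{C\}\,[p]\,\{C\} \mid \mathtt{if}(\varphi)\{C\}\mathtt{else}\{C\} \mid \mathtt{while}(\varphi)\{C\}$, where $x\in\mathrm{Vars}$, $e$ is an arithmetic expression (a measurable function $\Sigma\to\mathbb{R}$), $\mu$ is a (discrete or continuous) probability distribution on $\mathbb{R}$, $p\in[0,1]$, and $\varphi$ is a predicate. Loop bodies may themselves contain loops. Expectations: $\mathbb{E}$ is the set of measurable functions $f\colon\Sigma\to[0,\infty]$, ordered pointwise by $\preceq$. Convention $0\cdot\infty=0$. Weakest preexpectation $\mathrm{wp}[\![C]\!]\colon\mathbb{E}\to\mathbb{E}$, inductively: $\mathrm{wp}[\![\mathtt{skip}]\!](f)=f$; $\mathrm{wp}[\![x:=e]\!](f)(\sigma)=f(\sigma[x\mapsto e(\sigma)])$; $\mathrm{wp}[\![x:\approx\mu]\!](f)(\sigma)=\int_{\mathbb{R}}f(\sigma[x\mapsto\nu])\,d\mu(\nu)$; $\mathrm{wp}[\![C_1;C_2]\!](f)=\mathrm{wp}[\![C_1]\!](\mathrm{wp}[\![C_2]\!](f))$;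 $\mathrm{wp}[\![\{C_1\}[p]\{C_2\}]\!](f)=p\cdot\mathrm{wp}[\![C_1]\!](f)+(1-p)\cdot\mathrm{wp}[\![C_2]\!](f)$; $\mathrm{wp}[\![\mathtt{if}(\varphi)\{C_1\}\mathtt{else}\{C_2\}]\!](f)=[\varphi]\cdot\mathrm{wp}[\![C_1]\!](f)+[\neg\varphi]\cdot\mathrm{wp}[\![C_2]\!](f)$; and $\mathrm{wp}[\![\mathtt{while}(\varphi)\{C\}]\!](f)$ is the least fixed point, with respect to $\preceq$, of $h\mapsto[\neg\varphi]\cdot f+[\varphi]\cdot\mathrm{wp}[\![C]\!](h)$ on $\mathbb{E}$. For $\sigma\in\Sigma$, $\mu^{C}_{\sigma}$ denotes the subprobability measure on $\Sigma$ over final states of $C$ started in $\sigma$; it is characterized by $\mathrm{wp}[\![C]\!](f)(\sigma)=\int_\Sigma f\,d\mu^{C}_{\sigma}$ for all $f\in\mathbb{E}$, and $1-\mu_\sigma^C(\Sigma)$ is the probability that $C$ does not terminate on $\sigma$. Traces: fix a loop body $C$. Let $\bot\notin\Sigma$ be a sink state representing divergence of $C$; $\bot$ satisfies no predicate (neither $\varphi$ nor $\neg\varphi$). Let $\mathbb{S}$ be the set of infinite traces $\sigma_0\sigma_1\sigma_2\cdots$ with $\sigma_0\in\Sigma$, $\sigma_i\in\Sigma\cup\{\bot\}$ for $i\ge1$, and $\sigma_i=\bot\Rightarrow\sigma_{i+1}=\bot$. For $\sigma\in\Sigma$, $\mathbb{P}_\sigma$ is the measure on $\mathbb{S}$ (with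 the $\sigma$-algebra generated by cylinder sets) which is the law of the Markov chain started at $\sigma_0=\sigma$ that moves from $\tau\in\Sigma$ to the next state according to $\mu_\tau^C$, moves from $\tau$ to $\bot$ with probability $1-\mu^C_\tau(\Sigma)$, and stays in $\bot$ forever once there. (This is the operational behaviour of $\mathtt{while}(\mathtt{true})\{C\}$, one step per iteration of $C$; it does not depend on the guard.) $X_n(\sigma_0\sigma_1\cdots)=\sigma_n$ is the state after the $n$-th iteration. The looping time of $\mathtt{while}(\varphi)\{C\}$ is $T^{\neg\varphi}(s)=\inf\{n\in\mathbb{N}\mid X_n(s)\models\neg\varphi\}$ (with $\inf\emptyset=\infty$). In the bounded update property, states are viewed as real vectors of values of the (finitely many) variables occurring in the program, $|\cdot|$ is a norm on this space (e.g. the maximum norm), and the requirement includes that the $X_n$ are program states (elements of $\Sigma$) almost surely. Uniform integrability: a stochastic process $\{Y_n\}_{n\in\mathbb{N}}$ on a probability space is uniformly integrable if $\lim_{R\to\infty}\sup_{n\in\mathbb{N}}\mathbb{E}[|Y_n|\cdot\mathbf{1}_{|Y_n|\ge R}]=0$. An expectation $h$ is uniformly integrable for the loop $\mathtt{while}(\varphi)\{C\}$ if, for every initial state $\sigma\in\Sigma$, the process $\{h(X_n^{T^{\neg\varphi}})\}_{n\in\mathbb{N}}$ is uniformly integrable under $\mathbb{P}_\sigma$, where $X_n^{T^{\neg\varphi}}=X_n$ if $n\le T^{\neg\varphi}$ and $X_n^{T^{\neg\varphi}}=X_{T^{\neg\varphi}}$ otherwise (the stopped process). -}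

module Defs where

open import Algebra.Bundles using (CommutativeRing)
open import Algebra.Core using (Op₁; Op₂)
open import Algebra.Structures using (IsCommutativeRing)
import Algebra.Properties.Ring
open import Axiom.ExcludedMiddle using (ExcludedMiddle)
open import Data.Bool using (Bool; true; false; not; _∧_; T; if_then_else_)
open import Data.Empty using (⊥; ⊥-elim)
open import Data.Fin using (Fin)
open import Data.List using (List; []; _∷_)
open import Data.List.Relation.Unary.All using (All)
open import Data.Maybe using (Maybe; just; nothing; maybe′)
open import Data.Nat using (ℕ; zero; suc; _≤ᵇ_)
import Data.Nat as ℕ
open import Data.Product using (Σ; ∃; ∃₂; _×_; _,_; proj₁; proj₂)
open import Data.Sum using (_⊎_; inj₁; inj₂; [_,_]′)
open import Data.Unit using (⊤; tt)
open import Data.Vec using (Vec; lookup; tabulate; map; replicate; zipWith)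
open import Function using (_∘_; const)
open import Function.Bundles using (_↣_; Injection)
open import Level using (0ℓ)
open import Relation.Binary.Core using (Rel)
open import Relation.Binary.PropositionalEquality
  using (_≡_; _≢_; _≗_; refl; trans; subst)
open import Relation.Binary.Structures using (IsTotalOrder)
open import Relation.Nullary using (yes; no; does)
open import Relation.Nullary.Decidable using (recompute)

record IsLUB {A : Set} (_≤_ : Rel A 0ℓ) (P : A → Set) (s : A) : Set where
  field
    upper : ∀ {x} → P x → x ≤ s
    least : ∀ {b} → (∀ {x} → P x → x ≤ b) → s ≤ b

-- Over classical logic this determines the real numbers up to isomorphism.
record CompleteOrderedField : Set₁ where
  infixl 6 _+_
  infixl 7 _*_
  infix  8 -_
  infix  4 _≤_
  field
    ℝ                 : Set
    _+_ _*_           : Op₂ ℝ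
    -_                : Op₁ ℝ
    0# 1#             : ℝ
    _≤_               : Rel ℝ 0ℓ
    isCommutativeRing : IsCommutativeRing _≡_ _+_ _*_ -_ 0# 1#
    0≢1               : 0# ≢ 1#
    inverse           : ∀ {x} → x ≢ 0# → ∃ λ y → x * y ≡ 1#
    isTotalOrder      : IsTotalOrder _≡_ _≤_
    +-monoˡ-≤         : ∀ z {x y} → x ≤ y → x + z ≤ y + z
    *-nonneg          : ∀ {x y} → 0# ≤ x → 0# ≤ y → 0# ≤ x * y
    complete          : (P : ℝ → Set) → ∃ P → (∃ λ b → ∀ {x} → P x → x ≤ b) →
                        ∃ (IsLUB _≤_ P)

  commutativeRing : CommutativeRing 0ℓ 0ℓ
  commutativeRing = record { isCommutativeRing = isCommutativeRing }

  open CommutativeRing commutativeRing public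
    using (ring; +-identityˡ; -‿inverseʳ)
  open IsTotalOrder isTotalOrder public
    using (total) renaming (refl to ≤-refl; trans to ≤-trans)
  open Algebra.Properties.Ring ring public using (-1*x≈-x; -‿involutive)

  infix 4 _<_
  _<_ : Rel ℝ 0ℓ
  x < y = x ≤ y × x ≢ y

  ∣_∣ : ℝ → ℝ
  ∣ x ∣ = [ const x , const (- x) ]′ (total 0# x)

  +-nonneg : ∀ {x y} → 0# ≤ x → 0# ≤ y → 0# ≤ x + y
  +-nonneg {x} {y} 0≤x 0≤y =
    ≤-trans 0≤y (subst (_≤ x + y) (+-identityˡ y) (+-monoˡ-≤ y 0≤x))

  x≤y⇒0≤y-x : ∀ {x y} → x ≤ y → 0# ≤ y + - x
  x≤y⇒0≤y-x {x} {y} x≤y = subst (_≤ y + - x) (-‿inverseʳ x) (+-monoˡ-≤ (- x) x≤y)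

  0≤1 : 0# ≤ 1#
  0≤1 with total 0# 1#
  ... | inj₁ p = p
  ... | inj₂ 1≤0 = subst (0# ≤_) (trans (-1*x≈-x (- 1#)) (-‿involutive 1#)) (*-nonneg 0≤-1 0≤-1)
    where
    0≤-1 : 0# ≤ - 1#
    0≤-1 = subst (0# ≤_) (+-identityˡ (- 1#)) (x≤y⇒0≤y-x 1≤0)

-- The underlying logic of the development is classical, so excluded middle is
-- a parameter.
module Theory
  (em : ExcludedMiddle 0ℓ)
  (R : CompleteOrderedField)
  (Var : Set) (countable : Var ↣ ℕ)
  where

  open CompleteOrderedField R

  ----------------------------------------------------------------------
  -- The extended half-line [0,∞]

  data ℝ∞ : Set where
    fin : (r : ℝ) → .(0# ≤ r) → ℝ∞
    ∞   : ℝ∞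

  0∞ 1∞ : ℝ∞
  0∞ = fin 0# ≤-refl
  1∞ = fin 1# 0≤1

  infix 4 _≤∞_
  _≤∞_ : Rel ℝ∞ 0ℓ
  _       ≤∞ ∞       = ⊤
  fin r _ ≤∞ fin s _ = r ≤ s
  ∞       ≤∞ fin _ _ = ⊥

  infixl 6 _+∞_
  _+∞_ : Op₂ ℝ∞
  fin r p +∞ fin s q = fin (r + s) (+-nonneg p q)
  fin _ _ +∞ ∞       = ∞
  ∞       +∞ _       = ∞

  infixl 7 _*∞_
  _*∞_ : Op₂ ℝ∞
  fin r p *∞ fin s q = fin (r * s) (*-nonneg p q)
  fin r _ *∞ ∞       = if does (em {r ≡ 0#}) then 0∞ else ∞
  ∞       *∞ fin r _ = if does (em {r ≡ 0#}) then 0∞ else ∞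
  ∞       *∞ ∞       = ∞

  -- 1 - x, truncated at 0; only used for masses x ≤ 1.
  1∸_ : ℝ∞ → ℝ∞
  1∸ fin r _ with em {r ≤ 1#}
  ... | yes r≤1 = fin (1# + - r) (x≤y⇒0≤y-x r≤1)
  ... | no  _   = 0∞
  1∸ ∞ = 0∞

  supremum : (P : ℝ∞ → Set) → ∃ (IsLUB _≤∞_ P)
  supremum P with em {∃ λ b → b ≢ ∞ × (∀ {x} → P x → x ≤∞ b)}
  ... | no unbounded = ∞ , record { upper = λ _ → tt ; least = λ {b} → least {b} }
    where
    least : ∀ {b} → (∀ {x} → P x → x ≤∞ b) → ∞ ≤∞ b
    least {fin r p} bound = unbounded (fin r p , (λ ()) , bound)
    least {∞}       _     = tt
  ... | yes (∞ , b≢∞ , _) = ⊥-elim (b≢∞ refl)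
  ... | yes (fin b 0≤b , _ , bounded) = fin s (upper (inj₁ refl)) , record
    { upper = λ {x} → upper∞ {x} ; least = λ {x} → least∞ {x} }
    where
    Q : ℝ → Set
    Q r = r ≡ 0# ⊎ Σ (0# ≤ r) λ p → P (fin r p)

    Q≤b : ∀ {r} → Q r → r ≤ b
    Q≤b (inj₁ refl)     = recompute em 0≤b
    Q≤b (inj₂ (_ , Pr)) = bounded Pr

    lub = complete Q (0# , inj₁ refl) (b , Q≤b)
    s   = proj₁ lub
    open IsLUB (proj₂ lub)

    upper∞ : ∀ {x} → P x → x ≤∞ fin s (upper (inj₁ refl))
    upper∞ {fin r p} Px = upper (inj₂ (recompute em p , Px))
    upper∞ {∞}       Px = ⊥-elim (bounded Px)

    least∞ : ∀ {c} → (∀ {x} → P x → x ≤∞ c) → fin s (upper (inj₁ refl)) ≤∞ c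
    least∞ {fin r p} bound = least λ where
      (inj₁ refl)     → recompute em p
      (inj₂ (_ , Px)) → bound Px
    least∞ {∞} _ = tt

  sup : (ℝ∞ → Set) → ℝ∞
  sup P = proj₁ (supremum P)

  sup[_] : {I : Set} → (I → ℝ∞) → ℝ∞
  sup[ f ] = sup (λ x → ∃ λ i → x ≡ f i)

  ∑<_ : ℕ → (ℕ → ℝ∞) → ℝ∞
  (∑< zero) f  = 0∞
  (∑< suc n) f = (∑< n) f +∞ f n

  ∑∞ : (ℕ → ℝ∞) → ℝ∞
  ∑∞ f = sup[ (λ n → (∑< n) f) ]

  ----------------------------------------------------------------------
  -- Measure and integration

  -- By excluded middle, every subset has a Bool-valued characteristic function.
  Subset : Set → Set
  Subset A = A → Bool

  ⟦_⟧ : {A : Set} → (A → Set) → Subset A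
  ⟦ P ⟧ a = does (em {P a})

  infix 4 _∈_
  _∈_ : {A : Set} → A → Subset A → Set
  a ∈ B = T (B a)

  whole ∅ : {A : Set} → Subset A
  whole _ = true
  ∅ _     = false

  ∁ : {A : Set} → Subset A → Subset A
  ∁ B = not ∘ B

  ⋃ : {A : Set} → (ℕ → Subset A) → Subset A
  ⋃ B = ⟦ (λ a → ∃ λ n → a ∈ B n) ⟧

  [_] : {A : Set} → Subset A → A → ℝ∞
  [ B ] a = if B a then 1∞ else 0∞

  record MeasurableSpace : Set₁ where
    field
      Carrier    : Set
      Measurable : Subset Carrier → Set
      resp       : ∀ {B C} → B ≗ C → Measurable B → Measurable C
      empty      : Measurable ∅
      compl      : ∀ {B} → Measurable B → Measurable (∁ B)
      union      : (B : ℕ → Subset Carrier) → (∀ n → Measurable (B n)) → Measurable (⋃ B)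

  open MeasurableSpace using (Carrier; Measurable)

  data σ⟨_⟩ {A : Set} (G : Subset A → Set) : Subset A → Set where
    basic : ∀ {B} → G B → σ⟨ G ⟩ B
    resp  : ∀ {B C} → B ≗ C → σ⟨ G ⟩ B → σ⟨ G ⟩ C
    empty : σ⟨ G ⟩ ∅
    compl : ∀ {B} → σ⟨ G ⟩ B → σ⟨ G ⟩ (∁ B)
    union : (B : ℕ → Subset A) → (∀ n → σ⟨ G ⟩ (B n)) → σ⟨ G ⟩ (⋃ B)

  generatedBy : {A : Set} → (Subset A → Set) → MeasurableSpace
  generatedBy {A} G = record
    { Carrier = A ; Measurable = σ⟨ G ⟩
    ; resp = resp ; empty = empty ; compl = compl ; union = union }

  Borel : MeasurableSpace
  Borel = generatedBy {ℝ} λ B → ∃ λ (a : ℝ) → B ≗ ⟦ _≤ a ⟧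

  Borel∞ : MeasurableSpace
  Borel∞ = generatedBy {ℝ∞} λ B → ∃ λ (a : ℝ∞) → B ≗ ⟦ _≤∞ a ⟧

  IsMeasurable : (M N : MeasurableSpace) → (Carrier M → Carrier N) → Set
  IsMeasurable M N f = ∀ B → Measurable N B → Measurable M (B ∘ f)

  -- The set function is total, but its values outside the σ-algebra are
  -- unconstrained and carry no meaning.
  record Measure (M : MeasurableSpace) : Set where
    field
      ⟨_⟩      : Subset (Carrier M) → ℝ∞
      ext      : ∀ {B C} → Measurable M B → B ≗ C → ⟨ B ⟩ ≡ ⟨ C ⟩
      null     : ⟨ ∅ ⟩ ≡ 0∞
      additive : (B : ℕ → Subset (Carrier M)) → (∀ n → Measurable M (B n)) →
                 (∀ {m n a} → m ≢ n → a ∈ B m → a ∈ B n → ⊥) →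
                 ⟨ ⋃ B ⟩ ≡ ∑∞ (λ n → ⟨ B n ⟩)

  infix 9 _⟪_⟫
  _⟪_⟫ : ∀ {M} → Measure M → Subset (Carrier M) → ℝ∞
  μ ⟪ B ⟫ = Measure.⟨_⟩ μ B

  -- The list of the cᵢ and Aᵢ represents the simple function Σᵢ cᵢ·[Aᵢ]; the Aᵢ
  -- may overlap.
  Simple : MeasurableSpace → Set
  Simple M = List (Σ ℝ∞ (_≢ ∞) × Σ (Subset (Carrier M)) (Measurable M))

  evalSimple : ∀ {M} → Simple M → Carrier M → ℝ∞
  evalSimple []                              a = 0∞
  evalSimple {M} (((c , _) , A , _) ∷ s) a = c *∞ [ A ] a +∞ evalSimple {M} s a

  ∫Simple : ∀ {M} → Measure M → Simple M → ℝ∞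
  ∫Simple μ []                      = 0∞
  ∫Simple μ (((c , _) , A , _) ∷ s) = c *∞ μ ⟪ A ⟫ +∞ ∫Simple μ s

  ∫ : ∀ {M} → Measure M → (Carrier M → ℝ∞) → ℝ∞
  ∫ {M} μ f = sup λ x → ∃ λ (s : Simple M) →
    (∀ a → evalSimple {M} s a ≤∞ f a) × x ≡ ∫Simple μ s

  -- For a probability measure μ; A need not be measurable, and for measurable A
  -- this says μ(A) = 1.
  AlmostSurely : ∀ {M} → Measure M → (Carrier M → Set) → Set
  AlmostSurely {M} μ A =
    ∃ λ B → Measurable M B × μ ⟪ B ⟫ ≡ 1∞ × (∀ {a} → a ∈ B → A a)

  TendsTo0 : (ℝ → ℝ∞) → Set
  TendsTo0 f = ∀ ε (0<ε : 0# < ε) → ∃ λ r₀ → ∀ r → r₀ ≤ r → f r ≤∞ fin ε (proj₁ 0<ε)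

  -- For processes with values in [0,∞], so that |Yₙ| = Yₙ.
  UniformlyIntegrable : ∀ {M} → Measure M → (ℕ → Carrier M → ℝ∞) → Set
  UniformlyIntegrable μ Y = TendsTo0 λ r →
    sup[ (λ n → ∫ μ (λ a → Y n a *∞ [ ⟦ (λ b → r ≤[ Y n b ]) ⟧ ] a)) ]
    where
    _≤[_] : ℝ → ℝ∞ → Set
    r ≤[ fin s _ ] = r ≤ s
    r ≤[ ∞ ]       = ⊤

  ----------------------------------------------------------------------
  -- pGCL

  State : Set
  State = Var → ℝ

  States : MeasurableSpace
  States = generatedBy {State} λ B → ∃₂ λ (x : Var) (A : Subset ℝ) →
    Measurable Borel A × B ≗ (λ σ → A (σ x))

  _[_↦_] : State → Var → ℝ → State
  (σ [ x ↦ v ]) y = if does (em {x ≡ y}) then v else σ y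

  record Expr : Set where
    field
      eval       : State → ℝ
      measurable : IsMeasurable States Borel eval

  record Predicate : Set where
    field
      set        : Subset State
      measurable : Measurable States set

  record Distribution : Set where
    field
      measure : Measure Borel
      mass    : measure ⟪ whole ⟫ ≡ 1∞

  record Probability : Set where
    field
      value : ℝ
      lower : 0# ≤ value
      upper : value ≤ 1#

    p∞ 1-p∞ : ℝ∞
    p∞   = fin value lower
    1-p∞ = fin (1# + - value) (x≤y⇒0≤y-x upper)

  record 𝔼 : Set where
    field
      fun        : State → ℝ∞
      measurable : IsMeasurable States Borel∞ fun

  open Expr using (eval)
  open Predicate using (set)
  open Distribution using (measure)
  open Probability using (p∞; 1-p∞)
  open 𝔼 using (fun)

  infixr 4 _⨾_
  infix  5 _≔_ _:≈_
  data Program : Set where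
    skip          : Program
    _≔_           : Var → Expr → Program
    _:≈_          : Var → Distribution → Program
    _⨾_           : Program → Program → Program
    ⟨_⟩[_]⟨_⟩     : Program → Probability → Program → Program
    If_then_else_ : Predicate → Program → Program → Program
    while         : Predicate → Program → Program

  infix 4 _⪯_
  _⪯_ : 𝔼 → 𝔼 → Set
  f ⪯ g = ∀ σ → fun f σ ≤∞ fun g σ

  -- Wp C f g is the graph of the function wp: it says wp⟦ C ⟧(f) = g.  That wp is
  -- defined everywhere is a theorem about pGCL (measurability of parametrised
  -- integrals, existence of least fixed points), not part of its definition.
  Wp : Program → 𝔼 → 𝔼 → Set
  Wp skip            f g = ∀ σ → fun g σ ≡ fun f σ
  Wp (x ≔ e)         f g = ∀ σ → fun g σ ≡ fun f (σ [ x ↦ eval e σ ])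
  Wp (x :≈ μ)        f g = ∀ σ → fun g σ ≡ ∫ (measure μ) (λ ν → fun f (σ [ x ↦ ν ]))
  Wp (C₁ ⨾ C₂)       f g = ∃ λ k → Wp C₂ f k × Wp C₁ k g
  Wp ⟨ C₁ ⟩[ p ]⟨ C₂ ⟩ f g = ∃₂ λ g₁ g₂ → Wp C₁ f g₁ × Wp C₂ f g₂ ×
    (∀ σ → fun g σ ≡ p∞ p *∞ fun g₁ σ +∞ 1-p∞ p *∞ fun g₂ σ)
  Wp (If φ then C₁ else C₂) f g = ∃₂ λ g₁ g₂ → Wp C₁ f g₁ × Wp C₂ f g₂ ×
    (∀ σ → fun g σ ≡ [ set φ ] σ *∞ fun g₁ σ +∞ [ ∁ (set φ) ] σ *∞ fun g₂ σ)
  Wp (while φ C)     f g = FixedPoint g × (∀ h → FixedPoint h → g ⪯ h)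
    where
    FixedPoint : 𝔼 → Set
    FixedPoint h = ∃ λ k → Wp C h k ×
      (∀ σ → fun h σ ≡ [ ∁ (set φ) ] σ *∞ fun f σ +∞ [ set φ ] σ *∞ fun k σ)

  -- μ σ is the distribution of the final states of C started in σ.
  record IsFinalStateMeasure (C : Program) (μ : State → Measure States) : Set where
    field
      subprobability : ∀ σ → μ σ ⟪ whole ⟫ ≤∞ 1∞
      wp             : ∀ f → ∃ λ g → Wp C f g × (∀ σ → fun g σ ≡ ∫ (μ σ) (fun f))

  -- All variables of the program are among the finitely many variables listed;
  -- an expression or predicate, being a function on states, mentions only those
  -- variables if its value depends only on them.
  module _ {k : ℕ} (vars : Fin k ↣ Var) where

    open Injection vars using (to)

    Listed : Var → Set
    Listed x = ∃ λ i → to i ≡ x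

    DependsOnListed : {A : Set} → (State → A) → Set
    DependsOnListed f = ∀ σ τ → (∀ i → σ (to i) ≡ τ (to i)) → f σ ≡ f τ

    OnlyListed : Program → Set
    OnlyListed skip                    = ⊤
    OnlyListed (x ≔ e)                 = Listed x × DependsOnListed (eval e)
    OnlyListed (x :≈ μ)                = Listed x
    OnlyListed (C₁ ⨾ C₂)               = OnlyListed C₁ × OnlyListed C₂
    OnlyListed ⟨ C₁ ⟩[ p ]⟨ C₂ ⟩       = OnlyListed C₁ × OnlyListed C₂
    OnlyListed (If φ then C₁ else C₂)  = DependsOnListed (set φ) × OnlyListed C₁ × OnlyListed C₂
    OnlyListed (while φ C)             = DependsOnListed (set φ) × OnlyListed C

    vector : State → Vec ℝ k
    vector σ = tabulate (σ ∘ to)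

  ----------------------------------------------------------------------
  -- Traces; nothing is the sink state ⊥

  State⊥ : Set
  State⊥ = Maybe State

  States⊥ : MeasurableSpace
  States⊥ = record
    { Carrier    = State⊥
    ; Measurable = λ B → Measurable States (B ∘ just)
    ; resp       = λ B≗C → resp (B≗C ∘ just)
    ; empty      = empty
    ; compl      = compl
    ; union      = λ B → union (λ n → B n ∘ just)
    }

  record Trace : Set where
    field
      X        : ℕ → State⊥
      start    : X 0 ≢ nothing
      absorbed : ∀ i → X i ≡ nothing → X (suc i) ≡ nothing

  open Trace using (X)

  Traces : MeasurableSpace
  Traces = generatedBy {Trace} λ B → ∃₂ λ (n : ℕ) (A : Subset State⊥) →
    Measurable States⊥ A × B ≗ (λ s → A (X s n))

  -- Expected value of g after one transition of the chain.
  step : (State → Measure States) → (State⊥ → ℝ∞) → State⊥ → ℝ∞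
  step μ g (just τ) = ∫ (μ τ) (g ∘ just) +∞ (1∸ (μ τ ⟪ whole ⟫)) *∞ g nothing
  step μ g nothing  = g nothing

  -- Probability that the chain, started in τ, visits B₀, B₁, …, Bₘ at times 0, …, m.
  visits : (State → Measure States) → List (Subset State⊥) → State⊥ → ℝ∞
  visits μ []       τ = 1∞
  visits μ (B ∷ Bs) τ = [ B ] τ *∞ step μ (visits μ Bs) τ

  cylinder : ℕ → List (Subset State⊥) → Subset Trace
  cylinder n []       s = true
  cylinder n (B ∷ Bs) s = B (X s n) ∧ cylinder (suc n) Bs s

  IsChainLaw : (State → Measure States) → (State → Measure Traces) → Set
  IsChainLaw μ ℙ = ∀ σ Bs → All (Measurable States⊥) Bs →
    ℙ σ ⟪ cylinder 0 Bs ⟫ ≡ visits μ Bs (just σ)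

  _⊨¬_ : State⊥ → Predicate → Set
  just σ  ⊨¬ φ = σ ∈ ∁ (set φ)
  nothing ⊨¬ φ = ⊥

  -- Here nothing stands for ∞ = inf ∅.
  loopingTime : Predicate → Trace → Maybe ℕ
  loopingTime φ s with em {∃ λ n → X s n ⊨¬ φ × (∀ m → X s m ⊨¬ φ → n ℕ.≤ m)}
  ... | yes (n , _) = just n
  ... | no  _       = nothing

  _>ᵀ_ : Maybe ℕ → ℕ → Set
  just t  >ᵀ n = n ℕ.< t
  nothing >ᵀ n = ⊤

  stopped : Predicate → ℕ → Trace → State⊥
  stopped φ n s with loopingTime φ s
  ... | just t  = if n ≤ᵇ t then X s n else X s t
  ... | nothing = X s n

  -- The value in ⊥ is a convention; under bounded updates ⊥ is almost surely not
  -- reached.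
  atState⊥ : 𝔼 → State⊥ → ℝ∞
  atState⊥ h = maybe′ (fun h) 0∞

  UniformlyIntegrableFor : (State → Measure Traces) → Predicate → 𝔼 → Set
  UniformlyIntegrableFor ℙ φ h =
    ∀ σ → UniformlyIntegrable (ℙ σ) (λ n s → atState⊥ h (stopped φ n s))

  ----------------------------------------------------------------------
  -- Bounded updates and polynomials

  _-ᵛ_ : ∀ {k} → Vec ℝ k → Vec ℝ k → Vec ℝ k
  _-ᵛ_ = zipWith (λ x y → x + - y)

  record Norm (k : ℕ) : Set where
    field
      ∥_∥      : Vec ℝ k → ℝ
      nonneg   : ∀ v → 0# ≤ ∥ v ∥
      definite : ∀ v → ∥ v ∥ ≡ 0# → v ≡ replicate k 0#
      scale    : ∀ a v → ∥ map (a *_) v ∥ ≡ ∣ a ∣ * ∥ v ∥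
      triangle : ∀ v w → ∥ zipWith _+_ v w ∥ ≤ ∥ v ∥ + ∥ w ∥

  module _ {k : ℕ} (vars : Fin k ↣ Var) where

    UpdateWithin : Norm k → ℝ → State⊥ → State⊥ → Set
    UpdateWithin norm c (just σ) (just τ) = ∥ vector vars τ -ᵛ vector vars σ ∥ ≤ c
      where open Norm norm
    UpdateWithin norm c _ _ = ⊥

    BoundedUpdate : Norm k → (State → Measure Traces) → Set
    BoundedUpdate norm ℙ = ∃ λ c → 0# ≤ c ×
      (∀ σ → AlmostSurely (ℙ σ) λ s → ∀ n → UpdateWithin norm c (X s n) (X s (suc n)))

  data Polynomial (k : ℕ) : Set where
    con   : ℝ → Polynomial k
    var   : Fin k → Polynomial k
    _⊕_   : Polynomial k → Polynomial k → Polynomial k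
    _⊗_   : Polynomial k → Polynomial k → Polynomial k

  evalPoly : ∀ {k} → Polynomial k → Vec ℝ k → ℝ
  evalPoly (con a) v = a
  evalPoly (var i) v = lookup v i
  evalPoly (q ⊕ r) v = evalPoly q v + evalPoly r v
  evalPoly (q ⊗ r) v = evalPoly q v * evalPoly r v

  IsPolynomial : ∀ {k} → Fin k ↣ Var → 𝔼 → Set
  IsPolynomial {k} vars q = ∃ λ (r : Polynomial k) →
    ∀ σ → Σ (0# ≤ evalPoly r (vector vars σ)) λ nonneg →
      fun q σ ≡ fin (evalPoly r (vector vars σ)) nonneg

  PolynomiallyBounded : ∀ {k} → Fin k ↣ Var → 𝔼 → Set
  PolynomiallyBounded vars h = ∃ λ q → IsPolynomial vars q × h ⪯ q

{-# OPTIONS --safe #-}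
module Submission where

-- The tail T > bM of the looping time, M = N + 1, has probability at most p^b by the
-- Markov property.  With bounded updates the coordinates grow at most linearly along
-- a trace (all norms on ℝᵏ being equivalent), so that h is at most w(b), for a
-- polynomial w, at the times of the b-th block of M steps.  Hence the tail of
-- h(X_min(n,T)) above a large enough threshold is dominated, uniformly in n, by a
-- tail of the convergent series Σ w(b) p^b.

open import Algebra.Bundles using (CommutativeRing)
import Algebra.Properties.CommutativeSemiring.Exp
import Algebra.Properties.Ring
import Algebra.Properties.Semiring.Mult
import Algebra.Solver.Ring.NaturalCoefficients.Default
open import Axiom.ExcludedMiddle using (ExcludedMiddle)
open import Data.Bool using (true; false; not; _∧_; T; if_then_else_)
open import Data.Bool.Properties using (∧-assoc; ∧-comm)
open import Data.Empty using (⊥; ⊥-elim)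
open import Data.Fin using (Fin; zero; suc)
open import Data.List using (List; []; _∷_; _++_; replicate)
open import Data.List.Relation.Unary.All using (All; []; _∷_)
open import Data.List.Relation.Unary.All.Properties using (replicate⁺)
open import Data.Maybe using (just; nothing)
open import Data.Nat using (ℕ; zero; suc; _≤ᵇ_)
import Data.Nat as ℕ
import Data.Nat.DivMod as ℕ
import Data.Nat.Properties as ℕₚ
open import Data.Product using (Σ; ∃; ∃₂; _×_; _,_; proj₁; proj₂)
open import Data.Sum using (_⊎_; inj₁; inj₂)
open import Data.Unit using (tt)
open import Data.Vec using (Vec; []; _∷_; lookup; tabulate; map; zipWith)
import Data.Vec as Vec
open import Data.Vec.Properties
  using (∷-injectiveˡ; ∷-injectiveʳ; lookup-zipWith; lookup∘tabulate)
open import Function.Bundles using (_↣_; Injection)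
open import Level using (0ℓ)
open import Relation.Binary.Bundles using (Poset)
open import Relation.Binary.PropositionalEquality
  using (_≡_; _≢_; _≗_; refl; sym; trans; cong; cong₂; subst; subst₂; isEquivalence)
import Relation.Binary.Reasoning.PartialOrder
open import Relation.Binary.Structures using (IsTotalOrder)
open import Relation.Nullary using (¬_; yes; no)
open import Relation.Nullary.Decidable using (recompute)
open import Defs

-- `∫` is a supremum over simple functions, so the tail expectation is bounded by bounding every
-- simple function `s` below the tail. Such an `s` is compared with a finite sum of indicators by
-- refining sets. Finitely many terms are enough: at index n the process has stopped at a time t ≤
-- n, which lies in a block of number at most n. The estimate of the partial sums does not depend on
-- n.
--
-- The Markov property comes from the recursion of `visits`: a bound c on a list of visits, valid
-- from every state, factors out of `step`, since `step` is monotone and commutes with scaling by c.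
-- The bound has to hold in the sink too, where the hypothesis on T says nothing: a trace in ⊥ never
-- satisfies ¬φ, so it does not stop there. The tail events are therefore expressed by `guarded`,
-- which excludes ⊥. Almost every trace stays outside ⊥ by the bounded updates, so no relevant trace
-- is lost.
--
-- The degree of the polynomial is never computed: `Subexponential` is stable under sums and
-- products and so follows the syntax of `Polynomial`.

module OrderedField (em : ExcludedMiddle 0ℓ) (R : CompleteOrderedField) where

  open CompleteOrderedField R
  open CommutativeRing commutativeRing public
    using (semiring; commutativeSemiring; +-comm; +-assoc; +-identityʳ; *-comm; *-assoc;
           *-identityˡ; *-identityʳ; zeroˡ; zeroʳ; -‿inverseˡ; distribˡ; distribʳ)
  open Algebra.Properties.Ring ring public
    using (-‿+-comm; -0#≈0#; -‿distribˡ-*; -‿distribʳ-*)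
  open Algebra.Properties.CommutativeSemiring.Exp commutativeSemiring public using (_^_; ^-distrib-*)
  open Algebra.Properties.Semiring.Mult semiring public
    using (×-assocˡ; ×-assoc-*) renaming (_×_ to _·_)
  module Semiring-Solver = Algebra.Solver.Ring.NaturalCoefficients.Default commutativeSemiring
  open Semiring-Solver using (solve; _:+_; _:*_; _:=_; con)

  -- Arithmetic and order in a complete ordered field.

  poset : Poset 0ℓ 0ℓ 0ℓ
  poset = record { isPartialOrder = IsTotalOrder.isPartialOrder isTotalOrder }

  module ≤-Reasoning = Relation.Binary.Reasoning.PartialOrder poset

  open IsTotalOrder isTotalOrder public using ()
    renaming (antisym to ≤-antisym; reflexive to ≤-reflexive)

  x+[y-x]≡y : ∀ x y → x + (y + - x) ≡ y
  x+[y-x]≡y x y = trans (cong (x +_) (+-comm y (- x))) (trans (sym (+-assoc x (- x) y))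
    (trans (cong (_+ y) (-‿inverseʳ x)) (+-identityˡ y)))

  x-y+y≡x : ∀ x y → x + - y + y ≡ x
  x-y+y≡x x y = trans (+-assoc x (- y) y) (trans (cong (x +_) (-‿inverseˡ y)) (+-identityʳ x))

  -[x-y]≡y-x : ∀ x y → - (x + - y) ≡ y + - x
  -[x-y]≡y-x x y = trans (sym (-‿+-comm x (- y)))
    (trans (cong (- x +_) (-‿involutive y)) (+-comm (- x) y))

  ≤⇒∃+ : ∀ {x y} → x ≤ y → ∃ λ d → 0# ≤ d × y ≡ x + d
  ≤⇒∃+ {x} {y} x≤y = y + - x , x≤y⇒0≤y-x x≤y , sym (x+[y-x]≡y x y)

  +-mono-≤ : ∀ {x y u v} → x ≤ y → u ≤ v → x + u ≤ y + v
  +-mono-≤ {x} {y} {u} {v} x≤y u≤v = ≤-trans (+-monoˡ-≤ u x≤y)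
    (subst₂ _≤_ (+-comm u y) (+-comm v y) (+-monoˡ-≤ y u≤v))

  x≤x+y : ∀ {x y} → 0# ≤ y → x ≤ x + y
  x≤x+y {x} {y} 0≤y = subst (_≤ x + y) (+-identityʳ x) (+-mono-≤ ≤-refl 0≤y)

  x≤y+x : ∀ {x y} → 0# ≤ y → x ≤ y + x
  x≤y+x {x} {y} 0≤y = subst (_≤ y + x) (+-identityˡ x) (+-mono-≤ 0≤y ≤-refl)

  +-cancelʳ-≤ : ∀ {x y} z → x + z ≤ y + z → x ≤ y
  +-cancelʳ-≤ {x} {y} z le = subst₂ _≤_ (cancel x) (cancel y) (+-monoˡ-≤ (- z) le)
    where
    cancel : ∀ a → a + z + - z ≡ a
    cancel a = trans (+-assoc a z (- z)) (trans (cong (a +_) (-‿inverseʳ z)) (+-identityʳ a))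

  *-monoˡ-≤ : ∀ {x y z} → 0# ≤ z → x ≤ y → z * x ≤ z * y
  *-monoˡ-≤ {x} {y} {z} 0≤z x≤y with ≤⇒∃+ x≤y
  ... | d , 0≤d , refl = subst (z * x ≤_) (sym (distribˡ z x d)) (x≤x+y (*-nonneg 0≤z 0≤d))

  *-mono-≤ : ∀ {x y u v} → 0# ≤ x → 0# ≤ v → x ≤ y → u ≤ v → x * u ≤ y * v
  *-mono-≤ {x} {y} {u} {v} 0≤x 0≤v x≤y u≤v = ≤-trans (*-monoˡ-≤ 0≤x u≤v)
    (subst₂ _≤_ (*-comm v x) (*-comm v y) (*-monoˡ-≤ 0≤v x≤y))

  1≰0 : ¬ 1# ≤ 0#
  1≰0 1≤0 = 0≢1 (≤-antisym 0≤1 1≤0)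

  ≰⇒≥ : ∀ {x y} → ¬ x ≤ y → y ≤ x
  ≰⇒≥ {x} {y} x≰y with total x y
  ... | inj₁ x≤y = ⊥-elim (x≰y x≤y)
  ... | inj₂ y≤x = y≤x

  ≰⇒> : ∀ {x y} → ¬ x ≤ y → y < x
  ≰⇒> x≰y = ≰⇒≥ x≰y , λ { refl → x≰y ≤-refl }

  <⇒≱ : ∀ {x y} → x < y → ¬ y ≤ x
  <⇒≱ (x≤y , x≢y) y≤x = x≢y (≤-antisym x≤y y≤x)

  inverse-nonneg : ∀ {x y} → 0# ≤ x → x * y ≡ 1# → 0# ≤ y
  inverse-nonneg {x} {y} 0≤x xy≡1 with total 0# y
  ... | inj₁ 0≤y = 0≤y
  ... | inj₂ y≤0 = ⊥-elim (1≰0 (subst₂ _≤_ xy≡1 (zeroʳ x) (*-monoˡ-≤ 0≤x y≤0)))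

  abstract
    positive-inverse : ∀ {x} → 0# < x → ∃ λ y → 0# < y × x * y ≡ 1#
    positive-inverse {x} (0≤x , 0≢x) with inverse (λ x≡0 → 0≢x (sym x≡0))
    ... | y , xy≡1 = y , (inverse-nonneg 0≤x xy≡1 , λ { refl → 0≢1 (trans (sym (zeroʳ x)) xy≡1) }) , xy≡1

  *-pos : ∀ {x y} → 0# < x → 0# < y → 0# < x * y
  *-pos {x} {y} 0<x@(0≤x , _) (0≤y , 0≢y) = *-nonneg 0≤x 0≤y , λ 0≡xy →
    let z , _ , xz≡1 = positive-inverse 0<x in
    0≢y (trans (sym (zeroˡ z)) (trans (cong (_* z) 0≡xy)
      (trans (solve 3 (λ x y z → x :* y :* z := y :* (x :* z)) refl x y z)
             (trans (cong (y *_) xz≡1) (*-identityʳ y)))))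

  abstract
    half : ∃ λ h → 0# ≤ h × h + h ≡ 1#
    half with positive-inverse {1# + 1#} (+-nonneg 0≤1 0≤1 ,
                λ 0≡2 → 1≰0 (subst (1# ≤_) (sym 0≡2) (x≤x+y 0≤1)))
    ... | h , (0≤h , _) , 2h≡1 = h , 0≤h , trans (solve 1 (λ h → h :+ h := con 2 :* h) refl h) 
       (trans (cong (_* h) (solve 0 (con 2 := con 1 :+ con 1) refl)) 2h≡1)

  x<x+1 : ∀ {x} → ¬ x + 1# ≤ x
  x<x+1 {x} le = 1≰0 (+-cancelʳ-≤ x (subst₂ _≤_ (+-comm x 1#) (sym (+-identityˡ x)) le))

  ·-nonneg : ∀ n {x} → 0# ≤ x → 0# ≤ n · x
  ·-nonneg zero    0≤x = ≤-refl
  ·-nonneg (suc n) 0≤x = +-nonneg 0≤x (·-nonneg n 0≤x)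

  ·-monoˡ-≤ : ∀ {m n x} → 0# ≤ x → m ℕ.≤ n → m · x ≤ n · x
  ·-monoˡ-≤ {n = n} 0≤x ℕ.z≤n = ·-nonneg n 0≤x
  ·-monoˡ-≤ 0≤x (ℕ.s≤s m≤n) = +-mono-≤ ≤-refl (·-monoˡ-≤ 0≤x m≤n)

  ^-nonneg : ∀ x n → 0# ≤ x → 0# ≤ x ^ n
  ^-nonneg x zero    0≤x = 0≤1
  ^-nonneg x (suc n) 0≤x = *-nonneg 0≤x (^-nonneg x n 0≤x)

  ^-mono-≤ : ∀ x y n → 0# ≤ x → x ≤ y → x ^ n ≤ y ^ n
  ^-mono-≤ x y zero    0≤x x≤y = ≤-refl
  ^-mono-≤ x y (suc n) 0≤x x≤y =
    *-mono-≤ 0≤x (^-nonneg y n (≤-trans 0≤x x≤y)) x≤y (^-mono-≤ x y n 0≤x x≤y)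

  abstract
    -- If the multiples of `δ` were bounded, their supremum s would satisfy n · δ + δ ≤ s for all n.
    -- Then s - δ would bound them as well, forcing `δ` ≤ 0.
    archimedean : ∀ {δ} → 0# < δ → ∀ b → ∃ λ n → b ≤ n · δ
    archimedean {δ} (0≤δ , 0≢δ) b with em {∃ λ n → b ≤ n · δ}
    ... | yes p = p
    ... | no  unbounded = ⊥-elim (0≢δ (≤-antisym 0≤δ δ≤0))
      where
      lub : ∃ (IsLUB _≤_ (λ x → ∃ λ n → x ≡ n · δ))
      lub = complete (λ x → ∃ λ n → x ≡ n · δ) (0# , 0 , refl)
        (b , λ { (n , refl) → ≰⇒≥ λ b≤nδ → unbounded (n , b≤nδ) })
      s : ℝ
      s = proj₁ lub
      open IsLUB (proj₂ lub)

      s≤s-δ : s ≤ s + - δ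
      s≤s-δ = least λ { (n , refl) → +-cancelʳ-≤ δ (begin
        n · δ + δ        ≡⟨ +-comm (n · δ) δ ⟩
        suc n · δ        ≤⟨ upper (suc n , refl) ⟩
        s                ≡⟨ sym (+-identityʳ s) ⟩
        s + 0#           ≡⟨ cong (s +_) (sym (-‿inverseˡ δ)) ⟩
        s + (- δ + δ)    ≡⟨ sym (+-assoc s (- δ) δ) ⟩
        s + - δ + δ      ∎) }
        where open ≤-Reasoning

      δ≤0 : δ ≤ 0#
      δ≤0 = +-cancelʳ-≤ s (begin
        δ + s            ≡⟨ +-comm δ s ⟩
        s + δ            ≤⟨ +-mono-≤ s≤s-δ ≤-refl ⟩
        s + - δ + δ      ≡⟨ +-assoc s (- δ) δ ⟩
        s + (- δ + δ)    ≡⟨ cong (s +_) (-‿inverseˡ δ) ⟩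
        s + 0#           ≡⟨ +-comm s 0# ⟩
        0# + s           ∎)
        where open ≤-Reasoning

  -- Absolute values.

  ∣∣-cases : ∀ x → (0# ≤ x × ∣ x ∣ ≡ x) ⊎ (x ≤ 0# × ∣ x ∣ ≡ - x)
  ∣∣-cases x with total 0# x
  ... | inj₁ 0≤x = inj₁ (0≤x , refl)
  ... | inj₂ x≤0 = inj₂ (x≤0 , refl)

  x≤0⇒0≤-x : ∀ {x} → x ≤ 0# → 0# ≤ - x
  x≤0⇒0≤-x {x} x≤0 = subst (0# ≤_) (+-identityˡ (- x)) (x≤y⇒0≤y-x x≤0)

  0≤∣x∣ : ∀ x → 0# ≤ ∣ x ∣
  0≤∣x∣ x with ∣∣-cases x
  ... | inj₁ (0≤x , eq) = subst (0# ≤_) (sym eq) 0≤x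
  ... | inj₂ (x≤0 , eq) = subst (0# ≤_) (sym eq) (x≤0⇒0≤-x x≤0)

  x≤∣x∣ : ∀ x → x ≤ ∣ x ∣
  x≤∣x∣ x with ∣∣-cases x
  ... | inj₁ (0≤x , eq) = ≤-reflexive (sym eq)
  ... | inj₂ (x≤0 , eq) = ≤-trans x≤0 (0≤∣x∣ x)

  -x≤∣x∣ : ∀ x → - x ≤ ∣ x ∣
  -x≤∣x∣ x with ∣∣-cases x
  ... | inj₂ (x≤0 , eq) = ≤-reflexive (sym eq)
  ... | inj₁ (0≤x , eq) = ≤-trans
    (subst₂ _≤_ (+-identityˡ (- x)) (-‿inverseʳ x) (+-monoˡ-≤ (- x) 0≤x)) (0≤∣x∣ x)

  ∣x∣≤ : ∀ {x u} → x ≤ u → - x ≤ u → ∣ x ∣ ≤ u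
  ∣x∣≤ {x} x≤u -x≤u with ∣∣-cases x
  ... | inj₁ (_ , eq) = subst (_≤ _) (sym eq) x≤u
  ... | inj₂ (_ , eq) = subst (_≤ _) (sym eq) -x≤u

  ∣x+y∣≤ : ∀ {x y u v} → ∣ x ∣ ≤ u → ∣ y ∣ ≤ v → ∣ x + y ∣ ≤ u + v
  ∣x+y∣≤ {x} {y} {u} {v} x≤u y≤v = ∣x∣≤
    (+-mono-≤ (≤-trans (x≤∣x∣ x) x≤u) (≤-trans (x≤∣x∣ y) y≤v))
    (subst (_≤ u + v) (-‿+-comm x y)
      (+-mono-≤ (≤-trans (-x≤∣x∣ x) x≤u) (≤-trans (-x≤∣x∣ y) y≤v)))

  ∣∣-sign : ∀ x → x ≡ ∣ x ∣ ⊎ x ≡ - ∣ x ∣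
  ∣∣-sign x with ∣∣-cases x
  ... | inj₁ (_ , eq) = inj₁ (sym eq)
  ... | inj₂ (_ , eq) = inj₂ (trans (sym (-‿involutive x)) (cong -_ (sym eq)))

  ∣±∣≤ : ∀ {x u} → 0# ≤ u → x ≡ u ⊎ x ≡ - u → ∣ x ∣ ≤ u
  ∣±∣≤ {_} {u} 0≤u (inj₁ refl) = ∣x∣≤ ≤-refl (≤-trans (-x≤∣x∣ u)
    (≤-reflexive (nonneg-abs)))
    where
    nonneg-abs : ∣ u ∣ ≡ u
    nonneg-abs with ∣∣-cases u
    ... | inj₁ (_ , eq) = eq
    ... | inj₂ (u≤0 , eq) with ≤-antisym 0≤u u≤0
    ... | refl = trans eq -0#≈0#
  ∣±∣≤ {_} {u} 0≤u (inj₂ refl) = ∣x∣≤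
    (≤-trans (subst (- u ≤_) (-‿inverseʳ u) (x≤y+x 0≤u)) 0≤u)
    (≤-reflexive (-‿involutive u))

  ∣x*y∣≤ : ∀ {x y u v} → ∣ x ∣ ≤ u → ∣ y ∣ ≤ v → ∣ x * y ∣ ≤ u * v
  ∣x*y∣≤ {x} {y} {u} {v} x≤u y≤v = ≤-trans
    (∣±∣≤ (*-nonneg (0≤∣x∣ x) (0≤∣x∣ y)) (sign (∣∣-sign x) (∣∣-sign y)))
    (*-mono-≤ (0≤∣x∣ x) (≤-trans (0≤∣x∣ y) y≤v) x≤u y≤v)
    where
    a = ∣ x ∣
    b = ∣ y ∣
    sign : x ≡ a ⊎ x ≡ - a → y ≡ b ⊎ y ≡ - b → x * y ≡ a * b ⊎ x * y ≡ - (a * b)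
    sign (inj₁ p) (inj₁ q) = inj₁ (cong₂ _*_ p q)
    sign (inj₁ p) (inj₂ q) = inj₂ (trans (cong₂ _*_ p q) (sym (-‿distribʳ-* a b)))
    sign (inj₂ p) (inj₁ q) = inj₂ (trans (cong₂ _*_ p q) (sym (-‿distribˡ-* a b)))
    sign (inj₂ p) (inj₂ q) = inj₁ (trans (cong₂ _*_ p q)
      (trans (sym (-‿distribˡ-* a (- b))) (trans (cong -_ (sym (-‿distribʳ-* a b))) (-‿involutive (a * b)))))

  -- Growth slower than every exponential.

  -- δ stands for 1 - ρ, so that the identities needed hold in every commutative semiring.
  Ratio : ℝ → ℝ → Set
  Ratio ρ δ = 0# ≤ ρ × 0# < δ × ρ + δ ≡ 1#

  -- The bound is required for every ratio below 1, not just for the given p: in a product each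
  -- factor is damped by a larger ratio, roughly a square root of the original one.
  record Subexponential (w : ℕ → ℝ) : Set where
    field
      nonneg  : ∀ b → 0# ≤ w b
      bounded : ∀ {ρ δ} → Ratio ρ δ → ∃ λ K → 0# ≤ K × ∀ b → w b * ρ ^ b ≤ K

  open Subexponential

  -- (ρ + δ/2)² = ρ (ρ + δ) + (δ/2)² ≥ ρ.
  abstract
    sqrt-ratio : ∀ {ρ δ} → Ratio ρ δ → ∃₂ λ ρ′ δ′ → Ratio ρ′ δ′ × ρ ≤ ρ′ * ρ′
    sqrt-ratio {ρ} {δ} (0≤ρ , 0<δ@(0≤δ , _) , ρ+δ≡1) with half
    ... | h , 0≤h , h+h≡1 = ρ + h * δ , h * δ ,
      (+-nonneg 0≤ρ 0≤hδ , *-pos 0<h 0<δ , (begin-equality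
        ρ + h * δ + h * δ
          ≡⟨ solve 3 (λ ρ h δ → ρ :+ h :* δ :+ h :* δ := ρ :+ (h :+ h) :* δ) refl ρ h δ ⟩
        ρ + (h + h) * δ    ≡⟨ cong (λ x → ρ + x * δ) h+h≡1 ⟩
        ρ + 1# * δ         ≡⟨ cong (ρ +_) (*-identityˡ δ) ⟩
        ρ + δ              ≡⟨ ρ+δ≡1 ⟩
        1#                 ∎)) , (begin
      ρ                                            ≡⟨ sym (trans (cong (ρ *_) 2h) (*-identityʳ ρ)) ⟩
      ρ * (ρ + (h + h) * δ)                        ≤⟨ x≤x+y (*-nonneg 0≤hδ 0≤hδ) ⟩
      ρ * (ρ + (h + h) * δ) + (h * δ) * (h * δ)
        ≡⟨ solve 3 (λ ρ h δ → ρ :* (ρ :+ (h :+ h) :* δ) :+ (h :* δ) :* (h :* δ) :=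
          (ρ :+ h :* δ) :* (ρ :+ h :* δ)) refl ρ h δ ⟩
      (ρ + h * δ) * (ρ + h * δ)                    ∎)
      where
      open ≤-Reasoning
      0≤hδ : 0# ≤ h * δ
      0≤hδ = *-nonneg 0≤h 0≤δ
      0<h : 0# < h
      0<h = 0≤h , λ { refl → 0≢1 (trans (sym (+-identityˡ 0#)) h+h≡1) }
      2h : ρ + (h + h) * δ ≡ 1#
      2h = trans (cong (λ x → ρ + x * δ) h+h≡1) (trans (cong (ρ +_) (*-identityˡ δ)) ρ+δ≡1)

  ratio≤1 : ∀ {ρ δ} → Ratio ρ δ → ρ ≤ 1#
  ratio≤1 (_ , (0≤δ , _) , eq) = ≤-trans (x≤x+y 0≤δ) (≤-reflexive eq)

  ratio^≤1 : ∀ {ρ δ} → Ratio ρ δ → ∀ n → ρ ^ n ≤ 1#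
  ratio^≤1 r zero = ≤-refl
  ratio^≤1 r@(0≤ρ , _) (suc n) =
    ≤-trans (*-mono-≤ 0≤ρ 0≤1 (ratio≤1 r) (ratio^≤1 r n)) (≤-reflexive (*-identityʳ 1#))

  -- Bernoulli's inequality for 1/ρ ≥ 1 + δ with the denominator cleared, so that `ρ` may be 0. In
  -- the induction step δρ ≤ (1 + nδ)δ, and the factor ρ + δ = 1 splits off.
  bernoulli : ∀ {ρ δ} → Ratio ρ δ → ∀ n → (1# + n · δ) * ρ ^ n ≤ 1#
  bernoulli _ zero = ≤-reflexive (trans (*-identityʳ _) (+-identityʳ 1#))
  bernoulli {ρ} {δ} r@(0≤ρ , (0≤δ , _) , ρ+δ≡1) (suc n) = begin
    (1# + (δ + n · δ)) * (ρ * ρ ^ n)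
      ≡⟨ solve 4 (λ ρ δ x y → (con 1 :+ (δ :+ x)) :* (ρ :* y) :=
        ((con 1 :+ x) :* ρ :+ δ :* ρ) :* y) refl ρ δ (n · δ) (ρ ^ n) ⟩
    ((1# + n · δ) * ρ + δ * ρ) * ρ ^ n
      ≤⟨ *-mono-≤ (+-nonneg (*-nonneg 0≤1+nδ 0≤ρ) (*-nonneg 0≤δ 0≤ρ)) (^-nonneg ρ n 0≤ρ) (+-mono-≤ ≤-refl step) ≤-refl ⟩
    ((1# + n · δ) * ρ + (1# + n · δ) * δ) * ρ ^ n
      ≡⟨ cong (_* ρ ^ n) (sym (distribˡ (1# + n · δ) ρ δ)) ⟩
    (1# + n · δ) * (ρ + δ) * ρ ^ n       ≡⟨ cong (λ x → (1# + n · δ) * x * ρ ^ n) ρ+δ≡1 ⟩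
    (1# + n · δ) * 1# * ρ ^ n            ≡⟨ cong (_* ρ ^ n) (*-identityʳ _) ⟩
    (1# + n · δ) * ρ ^ n                 ≤⟨ bernoulli r n ⟩
    1#                                   ∎
    where
    open ≤-Reasoning
    0≤1+nδ = +-nonneg 0≤1 (·-nonneg n 0≤δ)
    step : δ * ρ ≤ (1# + n · δ) * δ
    step = subst (_≤ (1# + n · δ) * δ) (*-comm ρ δ)
      (*-mono-≤ 0≤ρ 0≤δ (≤-trans (ratio≤1 r) (x≤x+y (·-nonneg n 0≤δ))) ≤-refl)

  -- Serves both as the bound for linear growth and, read as ρⁿ ≤ 1/(nδ), as an explicit rate at
  -- which the powers tend to 0.
  n·δρⁿ≤1 : ∀ {ρ δ} → Ratio ρ δ → ∀ n → n · δ * ρ ^ n ≤ 1#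
  n·δρⁿ≤1 {ρ} r@(0≤ρ , (0≤δ , _) , _) n = ≤-trans
    (*-mono-≤ (·-nonneg n 0≤δ) (^-nonneg ρ n 0≤ρ) (x≤y+x 0≤1) ≤-refl) (bernoulli r n)

  subexponential-const : ∀ {a} → 0# ≤ a → Subexponential (λ _ → a)
  subexponential-const 0≤a .nonneg _ = 0≤a
  subexponential-const {a} 0≤a .bounded r = a , 0≤a , λ b →
    ≤-trans (*-monoˡ-≤ 0≤a (ratio^≤1 r b)) (≤-reflexive (*-identityʳ a))

  -- The bound is a/δ, with `γ` the inverse of `δ`: one factor `δ` is inserted to meet `n·δρⁿ≤1`.
  subexponential-linear : ∀ {a} → 0# ≤ a → Subexponential (λ b → b · a)
  subexponential-linear 0≤a .nonneg b = ·-nonneg b 0≤a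
  subexponential-linear {a} 0≤a .bounded {ρ} {δ} r@(_ , 0<δ , _) with positive-inverse 0<δ
  ... | γ , (0≤γ , _) , δγ≡1 = a * γ , *-nonneg 0≤a 0≤γ , λ b → begin
    b · a * ρ ^ b
      ≡⟨ cong (λ x → b · x * ρ ^ b) (sym (trans (cong (a *_) δγ≡1) (*-identityʳ a))) ⟩
    b · (a * (δ * γ)) * ρ ^ b
      ≡⟨ cong (λ x → b · x * ρ ^ b) (solve 3 (λ a δ γ → a :* (δ :* γ) :=
        δ :* (a :* γ)) refl a δ γ) ⟩
    b · (δ * (a * γ)) * ρ ^ b     ≡⟨ cong (_* ρ ^ b) (sym (×-assoc-* b δ (a * γ))) ⟩
    b · δ * (a * γ) * ρ ^ b
      ≡⟨ solve 3 (λ x y z → x :* y :* z := y :* (x :* z)) refl (b · δ) (a * γ) (ρ ^ b) ⟩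
    a * γ * (b · δ * ρ ^ b)       ≤⟨ *-monoˡ-≤ (*-nonneg 0≤a 0≤γ) (n·δρⁿ≤1 r b) ⟩
    a * γ * 1#                    ≡⟨ *-identityʳ (a * γ) ⟩
    a * γ                         ∎
    where open ≤-Reasoning

  subexponential-+ : ∀ {v w} → Subexponential v → Subexponential w → Subexponential (λ b → v b + w b)
  subexponential-+ V W .nonneg b = +-nonneg (V .nonneg b) (W .nonneg b)
  subexponential-+ {v} {w} V W .bounded {ρ} r with V .bounded r | W .bounded r
  ... | K , 0≤K , v≤K | L , 0≤L , w≤L = K + L , +-nonneg 0≤K 0≤L , λ b →
    ≤-trans (≤-reflexive (distribʳ (ρ ^ b) (v b) (w b))) (+-mono-≤ (v≤K b) (w≤L b))

  ^≤^*^ : ∀ ρ ρ′ b → 0# ≤ ρ → ρ ≤ ρ′ * ρ′ → ρ ^ b ≤ ρ′ ^ b * ρ′ ^ b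
  ^≤^*^ ρ ρ′ b 0≤ρ ρ≤ρ′² =
    ≤-trans {ρ ^ b} {(ρ′ * ρ′) ^ b} (^-mono-≤ ρ (ρ′ * ρ′) b 0≤ρ ρ≤ρ′²)
      (≤-reflexive {(ρ′ * ρ′) ^ b} {ρ′ ^ b * ρ′ ^ b} (^-distrib-* ρ′ ρ′ b))

  -- With ρ ≤ ρ′², the power ρ^b is shared out: one factor ρ′^b damps `v`, the other damps `w`.
  subexponential-* : ∀ {v w} → Subexponential v → Subexponential w → Subexponential (λ b → v b * w b)
  subexponential-* V W .nonneg b = *-nonneg (V .nonneg b) (W .nonneg b)
  subexponential-* {v} {w} V W .bounded {ρ} r@(0≤ρ , _) with sqrt-ratio r
  ... | ρ′ , δ′ , r′@(0≤ρ′ , _) , ρ≤ρ′² with V .bounded r′ | W .bounded r′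
  ... | K , 0≤K , v≤K | L , 0≤L , w≤L = K * L , *-nonneg 0≤K 0≤L , λ b → begin
    v b * w b * ρ ^ b
      ≤⟨ *-monoˡ-≤ (*-nonneg (V .nonneg b) (W .nonneg b)) (^≤^*^ ρ ρ′ b 0≤ρ ρ≤ρ′²) ⟩
    v b * w b * (ρ′ ^ b * ρ′ ^ b)
      ≡⟨ solve 3 (λ v w x → v :* w :* (x :* x) := (v :* x) :* (w :* x)) refl (v b) (w b) (ρ′ ^ b) ⟩
    (v b * ρ′ ^ b) * (w b * ρ′ ^ b)
      ≤⟨ *-mono-≤ (*-nonneg (V .nonneg b) (^-nonneg ρ′ b 0≤ρ′)) 0≤L (v≤K b) (w≤L b) ⟩
    K * L                                ∎
    where open ≤-Reasoning

  -- Tails of exponentially damped series.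

  sumFrom : (ℕ → ℝ) → ℕ → ℕ → ℝ
  sumFrom f b zero    = 0#
  sumFrom f b (suc n) = f b + sumFrom f (suc b) n

  sumFrom-mono-≤ : ∀ {f g} → (∀ b → f b ≤ g b) → ∀ b n → sumFrom f b n ≤ sumFrom g b n
  sumFrom-mono-≤ f≤g b zero    = ≤-refl
  sumFrom-mono-≤ f≤g b (suc n) = +-mono-≤ (f≤g b) (sumFrom-mono-≤ f≤g (suc b) n)

  -- The geometric series, multiplied by δ = 1 - ρ in place of a division. The induction peels off
  -- the first term and closes by ρ + δ = 1.
  sumFrom-geometric : ∀ {ρ δ K} → Ratio ρ δ → 0# ≤ K → ∀ b n →
                      sumFrom (λ i → K * ρ ^ i) b n * δ ≤ K * ρ ^ b
  sumFrom-geometric {ρ} {δ} (0≤ρ , _) 0≤K b zero =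
    ≤-trans (≤-reflexive (zeroˡ δ)) (*-nonneg 0≤K (^-nonneg ρ b 0≤ρ))
  sumFrom-geometric {ρ} {δ} {K} r@(_ , _ , ρ+δ≡1) 0≤K b (suc n) = begin
    (K * ρ ^ b + s) * δ                ≡⟨ distribʳ δ _ s ⟩
    K * ρ ^ b * δ + s * δ              ≤⟨ +-mono-≤ ≤-refl (sumFrom-geometric r 0≤K (suc b) n) ⟩
    K * ρ ^ b * δ + K * (ρ * ρ ^ b)
      ≡⟨ solve 4 (λ K x δ ρ → K :* x :* δ :+ K :* (ρ :* x) :=
        K :* x :* (ρ :+ δ)) refl K (ρ ^ b) δ ρ ⟩
    K * ρ ^ b * (ρ + δ)                ≡⟨ cong (K * ρ ^ b *_) ρ+δ≡1 ⟩
    K * ρ ^ b * 1#                     ≡⟨ *-identityʳ _ ⟩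
    K * ρ ^ b                          ∎
    where
    open ≤-Reasoning
    s = sumFrom (λ i → K * ρ ^ i) (suc b) n

  *-cancelʳ-≤-pos : ∀ {x y z} → 0# < z → x * z ≤ y * z → x ≤ y
  *-cancelʳ-≤-pos {x} {y} {z} 0<z le with positive-inverse 0<z
  ... | z⁻¹ , (0≤z⁻¹ , _) , zz⁻¹≡1 = subst₂ _≤_ (cancel x) (cancel y) (*-monoˡ-≤ 0≤z⁻¹ le)
    where
    cancel : ∀ a → z⁻¹ * (a * z) ≡ a
    cancel a = trans (solve 3 (λ i a z → i :* (a :* z) := a :* (z :* i)) refl z⁻¹ a z)
                     (trans (cong (a *_) zz⁻¹≡1) (*-identityʳ a))

  -- With p ≤ ρ², one factor ρ^b reduces `w` to the constant `K`, and the other leaves a geometric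
  -- series.
  subexponential-tail : ∀ {w p δ} → Subexponential w → Ratio p δ → ∀ {ε} → 0# < ε →
                        ∃ λ J → ∀ n → sumFrom (λ b → w b * p ^ b) J n ≤ ε
  subexponential-tail {w} {p} W r@(0≤p , _) {ε} 0<ε@(0≤ε , _) with sqrt-ratio r
  ... | ρ , δ , r′@(0≤ρ , 0<δ@(0≤δ , _) , _) , p≤ρ² with W .bounded r′
  -- `J` is chosen with K ≤ Jδ · εδ. The factor Jδ is absorbed by ρ^J, since Jδρ^J ≤ 1, and the
  -- remaining δ cancels the one from the geometric series.
  ... | K , 0≤K , w≤K with archimedean (*-pos 0<δ (*-pos 0<ε 0<δ)) K
  ... | J , K≤Jδεδ = J , λ n → *-cancelʳ-≤-pos 0<δ (begin
    sumFrom (λ b → w b * p ^ b) J n * δ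
      ≤⟨ *-mono-≤ (sumFrom-nonneg J n) 0≤δ (sumFrom-mono-≤ term J n) ≤-refl ⟩
    sumFrom (λ b → K * ρ ^ b) J n * δ     ≤⟨ sumFrom-geometric r′ 0≤K J n ⟩
    K * ρ ^ J                             ≤⟨ *-mono-≤ 0≤K (^-nonneg ρ J 0≤ρ) K≤Jδεδ ≤-refl ⟩
    J · (δ * (ε * δ)) * ρ ^ J             ≡⟨ cong (_* ρ ^ J) (sym (×-assoc-* J δ (ε * δ))) ⟩
    J · δ * (ε * δ) * ρ ^ J
      ≡⟨ solve 3 (λ x y z → x :* y :* z := y :* (x :* z)) refl (J · δ) (ε * δ) (ρ ^ J) ⟩
    ε * δ * (J · δ * ρ ^ J)               ≤⟨ *-monoˡ-≤ (*-nonneg 0≤ε 0≤δ) (n·δρⁿ≤1 r′ J) ⟩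
    ε * δ * 1#                            ≡⟨ *-identityʳ (ε * δ) ⟩
    ε * δ                                 ∎)
    where
    open ≤-Reasoning
    sumFrom-nonneg : ∀ b n → 0# ≤ sumFrom (λ b → w b * p ^ b) b n
    sumFrom-nonneg b zero    = ≤-refl
    sumFrom-nonneg b (suc n) = +-nonneg (*-nonneg (W .nonneg b) (^-nonneg p b 0≤p)) (sumFrom-nonneg (suc b) n)

    term : ∀ b → w b * p ^ b ≤ K * ρ ^ b
    term b = begin
      w b * p ^ b               ≤⟨ *-monoˡ-≤ (W .nonneg b) (^≤^*^ p ρ b 0≤p p≤ρ²) ⟩
      w b * (ρ ^ b * ρ ^ b)     ≡⟨ sym (*-assoc (w b) (ρ ^ b) (ρ ^ b)) ⟩
      w b * ρ ^ b * ρ ^ b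
        ≤⟨ *-mono-≤ (*-nonneg (W .nonneg b) (^-nonneg ρ b 0≤ρ)) (^-nonneg ρ b 0≤ρ) (w≤K b) ≤-refl ⟩
      K * ρ ^ b                 ∎

-- Equivalence of norms on ℝᵏ.

module Norms (em : ExcludedMiddle 0ℓ) (R : CompleteOrderedField)
  (Var : Set) (countable : Var ↣ ℕ) where

  open CompleteOrderedField R
  open OrderedField em R
  open Semiring-Solver using (solve; _:+_; _:*_; _:=_; con)
  open Theory em R Var countable

  ∣0∣≤0 : ∣ 0# ∣ ≤ 0#
  ∣0∣≤0 = ∣x∣≤ ≤-refl (≤-reflexive -0#≈0#)

  ∣-x∣≤∣x∣ : ∀ x → ∣ - x ∣ ≤ ∣ x ∣
  ∣-x∣≤∣x∣ x = ∣x∣≤ (-x≤∣x∣ x) (≤-trans (≤-reflexive (-‿involutive x)) (x≤∣x∣ x))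

  -- For positive `x` the choice ε = x/(1 + C) gives ε + εC = x ≤ εC, contradicting ε > 0.
  ≤ε*C⇒≤0 : ∀ {x C} → 0# ≤ C → (∀ ε → 0# < ε → x ≤ ε * C) → x ≤ 0#
  ≤ε*C⇒≤0 {x} {C} 0≤C small with em {x ≤ 0#}
  ... | yes x≤0 = x≤0
  ... | no  x≰0 with positive-inverse {1# + C}
        (+-nonneg 0≤1 0≤C , λ 0≡1+C → 1≰0 (≤-trans (x≤x+y 0≤C) (≤-reflexive (sym 0≡1+C))))
  ... | γ , 0<γ , [1+C]γ≡1 = ⊥-elim (<⇒≱ 0<xγ (+-cancelʳ-≤ (x * γ * C) (begin
    x * γ + x * γ * C
      ≡⟨ solve 3 (λ x γ C → x :* γ :+ x :* γ :* C := x :* ((con 1 :+ C) :* γ)) refl x γ C ⟩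
    x * ((1# + C) * γ) ≡⟨ trans (cong (x *_) [1+C]γ≡1) (*-identityʳ x) ⟩
    x                  ≤⟨ small (x * γ) 0<xγ ⟩
    x * γ * C          ≡⟨ sym (+-identityˡ _) ⟩
    0# + x * γ * C     ∎)))
    where
    open ≤-Reasoning
    0<xγ = *-pos (≰⇒> x≰0) 0<γ

  infixl 6 _+ᵛ_
  _+ᵛ_ : ∀ {k} → Vec ℝ k → Vec ℝ k → Vec ℝ k
  _+ᵛ_ = zipWith _+_

  infixl 7 _*ᵛ_
  _*ᵛ_ : ∀ {k} → ℝ → Vec ℝ k → Vec ℝ k
  a *ᵛ v = map (a *_) v

  0ᵛ : ∀ {k} → Vec ℝ k
  0ᵛ = Vec.replicate _ 0#

  *ᵛ-zeroʳ : ∀ {k} a → a *ᵛ 0ᵛ {k} ≡ 0ᵛ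
  *ᵛ-zeroʳ {zero}  a = refl
  *ᵛ-zeroʳ {suc k} a = cong₂ _∷_ (zeroʳ a) (*ᵛ-zeroʳ a)

  +ᵛ-identityˡ : ∀ {k} (v : Vec ℝ k) → 0ᵛ +ᵛ v ≡ v
  +ᵛ-identityˡ []      = refl
  +ᵛ-identityˡ (a ∷ v) = cong₂ _∷_ (+-identityˡ a) (+ᵛ-identityˡ v)

  a*0+v≡v : ∀ {k} a (v : Vec ℝ k) → a *ᵛ 0ᵛ +ᵛ v ≡ v
  a*0+v≡v a v = trans (cong (_+ᵛ v) (*ᵛ-zeroʳ a)) (+ᵛ-identityˡ v)

  v+[w-v]≡w : ∀ {k} (v w : Vec ℝ k) → v +ᵛ (w -ᵛ v) ≡ w
  v+[w-v]≡w []      []      = refl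
  v+[w-v]≡w (a ∷ v) (b ∷ w) = cong₂ _∷_ (x+[y-x]≡y a b) (v+[w-v]≡w v w)

  v+-1*w≡v-w : ∀ {k} (v w : Vec ℝ k) → v +ᵛ - 1# *ᵛ w ≡ v -ᵛ w
  v+-1*w≡v-w []      []      = refl
  v+-1*w≡v-w (a ∷ v) (b ∷ w) = cong₂ _∷_ (cong (a +_) (-1*x≈-x b)) (v+-1*w≡v-w v w)

  inverse-*ᵛ : ∀ {k a b} → a * b ≡ 1# → (v : Vec ℝ k) → a *ᵛ (b *ᵛ v) ≡ v
  inverse-*ᵛ ab≡1 []      = refl
  inverse-*ᵛ {a = a} {b} ab≡1 (x ∷ v) = cong₂ _∷_
    (trans (sym (*-assoc a b x)) (trans (cong (_* x) ab≡1) (*-identityˡ x))) (inverse-*ᵛ ab≡1 v)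

  open Norm using (∥_∥)

  -- The restriction to the hyperplane of vectors with first coordinate 0; the inductions on the
  -- dimension descend to it.
  tailNorm : ∀ {k} → Norm (suc k) → Norm k
  tailNorm norm = record
    { ∥_∥      = λ v → N.∥ 0# ∷ v ∥
    ; nonneg   = λ v → N.nonneg (0# ∷ v)
    ; definite = λ v eq → ∷-injectiveʳ (N.definite (0# ∷ v) eq)
    ; scale    = λ a v → trans (cong (λ x → N.∥ x ∷ a *ᵛ v ∥) (sym (zeroʳ a))) (N.scale a (0# ∷ v))
    ; triangle = λ v w → subst (λ x → N.∥ x ∷ v +ᵛ w ∥ ≤ N.∥ 0# ∷ v ∥ + N.∥ 0# ∷ w ∥)
                               (+-identityˡ 0#) (N.triangle (0# ∷ v) (0# ∷ w))
    }
    where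
    module N = Norm norm

  module _ {k} (norm : Norm (suc k)) where
    private
      module N = Norm norm
      e = N.∥ 1# ∷ 0ᵛ ∥
      0≤e = N.nonneg (1# ∷ 0ᵛ)

    ∥a∷v∥≤ : ∀ a v → N.∥ a ∷ v ∥ ≤ ∣ a ∣ * e + N.∥ 0# ∷ v ∥
    ∥a∷v∥≤ a v = begin
      N.∥ a ∷ v ∥
        ≡⟨ cong N.∥_∥ (sym (cong₂ _∷_ (trans (+-identityʳ _) (*-identityʳ a)) (a*0+v≡v a v))) ⟩
      N.∥ a *ᵛ (1# ∷ 0ᵛ) +ᵛ (0# ∷ v) ∥            ≤⟨ N.triangle _ _ ⟩
      N.∥ a *ᵛ (1# ∷ 0ᵛ) ∥ + N.∥ 0# ∷ v ∥         ≡⟨ cong (_+ N.∥ 0# ∷ v ∥) (N.scale a (1# ∷ 0ᵛ)) ⟩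
      ∣ a ∣ * e + N.∥ 0# ∷ v ∥                    ∎
      where open ≤-Reasoning

    ∥0∷v∥≤ : ∀ a v → N.∥ 0# ∷ v ∥ ≤ ∣ a ∣ * e + N.∥ a ∷ v ∥
    ∥0∷v∥≤ a v = begin
      N.∥ 0# ∷ v ∥
        ≡⟨ cong N.∥_∥ (sym (cong₂ _∷_ (trans (cong (_+ a) (*-identityʳ (- a))) (-‿inverseˡ a)) (a*0+v≡v (- a) v))) ⟩
      N.∥ - a *ᵛ (1# ∷ 0ᵛ) +ᵛ (a ∷ v) ∥           ≤⟨ N.triangle _ _ ⟩
      N.∥ - a *ᵛ (1# ∷ 0ᵛ) ∥ + N.∥ a ∷ v ∥
        ≡⟨ cong (_+ N.∥ a ∷ v ∥) (N.scale (- a) (1# ∷ 0ᵛ)) ⟩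
      ∣ - a ∣ * e + N.∥ a ∷ v ∥
        ≤⟨ +-mono-≤ (*-mono-≤ (0≤∣x∣ (- a)) 0≤e (∣-x∣≤∣x∣ a) ≤-refl) ≤-refl ⟩
      ∣ a ∣ * e + N.∥ a ∷ v ∥                     ∎
      where open ≤-Reasoning

    -- By homogeneity: for a ≠ 0 the vector `a ∷ w` is `a` times a vector with head 1.
    head-bound : ∀ {d} → 0# < d → (∀ w → d ≤ N.∥ 1# ∷ w ∥) → ∀ a w → ∣ a ∣ * d ≤ N.∥ a ∷ w ∥
    head-bound {d} (0≤d , _) below a w with em {a ≡ 0#}
    ... | yes refl = ≤-trans (≤-trans (*-mono-≤ (0≤∣x∣ 0#) 0≤d ∣0∣≤0 ≤-refl) (≤-reflexive (zeroˡ d))) (N.nonneg _)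
    ... | no  a≢0 with inverse a≢0
    ... | b , ab≡1 = begin
      ∣ a ∣ * d                        ≤⟨ *-monoˡ-≤ (0≤∣x∣ a) (below (b *ᵛ w)) ⟩
      ∣ a ∣ * N.∥ 1# ∷ b *ᵛ w ∥        ≡⟨ sym (N.scale a (1# ∷ b *ᵛ w)) ⟩
      N.∥ a *ᵛ (1# ∷ b *ᵛ w) ∥
        ≡⟨ cong N.∥_∥ (cong₂ _∷_ (*-identityʳ a) (inverse-*ᵛ ab≡1 w)) ⟩
      N.∥ a ∷ w ∥                      ∎
      where open ≤-Reasoning

    -- Vectors with equal heads differ by a vector of the hyperplane, where the coordinates are
    -- already controlled. This yields the Cauchy property of vectors of small norm.
    ∥0∷v-w∥≤ : ∀ a v w → N.∥ 0# ∷ v -ᵛ w ∥ ≤ N.∥ a ∷ v ∥ + N.∥ a ∷ w ∥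
    ∥0∷v-w∥≤ a v w = begin
      N.∥ 0# ∷ v -ᵛ w ∥
        ≡⟨ cong N.∥_∥ (sym (cong₂ _∷_ (trans (cong (a +_) (-1*x≈-x a)) (-‿inverseʳ a)) (v+-1*w≡v-w v w))) ⟩
      N.∥ (a ∷ v) +ᵛ - 1# *ᵛ (a ∷ w) ∥         ≤⟨ N.triangle _ _ ⟩
      N.∥ a ∷ v ∥ + N.∥ - 1# *ᵛ (a ∷ w) ∥      ≡⟨ cong (N.∥ a ∷ v ∥ +_) (N.scale (- 1#) (a ∷ w)) ⟩
      N.∥ a ∷ v ∥ + ∣ - 1# ∣ * N.∥ a ∷ w ∥
        ≤⟨ +-mono-≤ ≤-refl (*-mono-≤ (0≤∣x∣ (- 1#)) (N.nonneg _) (∣±∣≤ 0≤1 (inj₂ refl)) ≤-refl) ⟩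
      N.∥ a ∷ v ∥ + 1# * N.∥ a ∷ w ∥           ≡⟨ cong (N.∥ a ∷ v ∥ +_) (*-identityˡ _) ⟩
      N.∥ a ∷ v ∥ + N.∥ a ∷ w ∥                ∎
      where open ≤-Reasoning

  abstract
    -- `U` is the sum of the norms of the unit vectors.
    norm≤coordinates : ∀ {k} (norm : Norm k) → ∃ λ U → 0# ≤ U ×
                       ∀ v u → (∀ i → ∣ lookup v i ∣ ≤ u) → ∥ norm ∥ v ≤ U * u
    norm≤coordinates {zero} norm = 0# , ≤-refl , λ { [] u _ → ≤-trans
      (≤-trans (≤-reflexive (Norm.scale norm 0# []))
        (*-mono-≤ (0≤∣x∣ 0#) (Norm.nonneg norm []) ∣0∣≤0 ≤-refl))
      (≤-reflexive (trans (zeroˡ _) (sym (zeroˡ u)))) }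
    norm≤coordinates {suc k} norm with norm≤coordinates (tailNorm norm)
    ... | U , 0≤U , tail≤ = e + U , +-nonneg 0≤e 0≤U , λ { (a ∷ v) u ≤u →
      ≤-trans (∥a∷v∥≤ norm a v) (≤-trans
        (+-mono-≤ (≤-trans (≤-reflexive (*-comm ∣ a ∣ e)) (*-monoˡ-≤ 0≤e (≤u zero)))
                  (tail≤ v u (λ i → ≤u (suc i))))
        (≤-reflexive (sym (distribʳ u e U)))) }
      where
      e : ℝ
      e = ∥ norm ∥ (1# ∷ 0ᵛ)
      0≤e : 0# ≤ e
      0≤e = Norm.nonneg norm (1# ∷ 0ᵛ)

  -- A vector 1 ∷ w of norm 0 would exist as the limit of vectors of small norm, the
  -- bounds K and U on the hyperplane 0 ∷ w providing convergence of the coordinates.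
  module _ {k} (norm : Norm (suc k))
    {K} (0≤K : 0# ≤ K) (coordinate≤ : ∀ v i → ∣ lookup v i ∣ ≤ K * ∥ norm ∥ (0# ∷ v))
    (small : ∀ ε → 0# < ε → ∃ λ w → ∥ norm ∥ (1# ∷ w) ≤ ε) where
    private
      module N = Norm norm

      -- A lower cut for the i-th coordinate of the limit: the reals below that coordinate in all
      -- `1# ∷ w` of small enough norm. Its supremum is the limit, so no sequence has to be chosen.
      Below : Fin k → ℝ → Set
      Below i r = ∃ λ ε → 0# < ε × ∀ w → N.∥ 1# ∷ w ∥ ≤ ε → r ≤ lookup w i

      close : ∀ {ε v w} → N.∥ 1# ∷ v ∥ ≤ ε → N.∥ 1# ∷ w ∥ ≤ ε → ∀ i →
              ∣ lookup v i + - lookup w i ∣ ≤ K * (ε + ε)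
      close {ε} {v} {w} v≤ε w≤ε i = begin
        ∣ lookup v i + - lookup w i ∣  ≡⟨ cong ∣_∣ (sym (lookup-zipWith (λ x y → x + - y) i v w)) ⟩
        ∣ lookup (v -ᵛ w) i ∣          ≤⟨ coordinate≤ (v -ᵛ w) i ⟩
        K * N.∥ 0# ∷ v -ᵛ w ∥
          ≤⟨ *-monoˡ-≤ 0≤K (≤-trans (∥0∷v-w∥≤ norm 1# v w) (+-mono-≤ v≤ε w≤ε)) ⟩
        K * (ε + ε)                    ∎
        where open ≤-Reasoning

      bounds : ∀ {x y D} → ∣ x + - y ∣ ≤ D → x ≤ y + D
      bounds {x} {y} {D} le = begin
        x              ≡⟨ sym (x+[y-x]≡y y x) ⟩
        y + (x + - y)  ≤⟨ +-mono-≤ ≤-refl (≤-trans (x≤∣x∣ _) le) ⟩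
        y + D          ∎
        where open ≤-Reasoning

      both : ∀ ε δ → 0# < ε → 0# < δ → ∃ λ w → N.∥ 1# ∷ w ∥ ≤ ε × N.∥ 1# ∷ w ∥ ≤ δ
      both ε δ 0<ε 0<δ with total ε δ
      ... | inj₁ ε≤δ = let w , w≤ε = small ε 0<ε in w , w≤ε , ≤-trans w≤ε ε≤δ
      ... | inj₂ δ≤ε = let w , w≤δ = small δ 0<δ in w , ≤-trans w≤δ δ≤ε , w≤δ

      -- A vector small for both radii links the bound known at radius `δ` with the vector known at
      -- radius `ε`.
      below≤ : ∀ {ε w i r} → 0# < ε → N.∥ 1# ∷ w ∥ ≤ ε → Below i r → r ≤ lookup w i + K * (ε + ε)
      below≤ {ε} {w} {i} 0<ε w≤ε (δ , 0<δ , r≤) = let v , v≤ε , v≤δ = both ε δ 0<ε 0<δ in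
        ≤-trans (r≤ v v≤δ) (bounds (close v≤ε w≤ε i))

      isBelow : ∀ {ε w} i → 0# < ε → N.∥ 1# ∷ w ∥ ≤ ε → Below i (lookup w i + - (K * (ε + ε)))
      isBelow {ε} {w} i 0<ε w≤ε = ε , 0<ε , λ v v≤ε → +-cancelʳ-≤ (K * (ε + ε)) (begin
        lookup w i + - D + D    ≡⟨ x-y+y≡x (lookup w i) D ⟩
        lookup w i              ≤⟨ bounds (close w≤ε v≤ε i) ⟩
        lookup v i + D          ∎)
        where
        open ≤-Reasoning
        D = K * (ε + ε)

      limit : ∀ i → ∃ (IsLUB _≤_ (Below i))
      limit i = let w , w≤1 = small 1# (0≤1 , 0≢1) in
        complete (Below i) (_ , isBelow i (0≤1 , 0≢1) w≤1) (_ , below≤ (0≤1 , 0≢1) w≤1)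

      w* : Vec ℝ k
      w* = tabulate (λ i → proj₁ (limit i))

      w*-close : ∀ {ε w} → 0# < ε → N.∥ 1# ∷ w ∥ ≤ ε → ∀ i → ∣ lookup (w* -ᵛ w) i ∣ ≤ K * (ε + ε)
      w*-close {ε} {w} 0<ε w≤ε i = ≤-trans
        (≤-reflexive (cong ∣_∣ (trans (lookup-zipWith (λ x y → x + - y) i w* w) (cong (_+ - lookup w i) (lookup∘tabulate _ i)))))
        (∣x∣≤ (+-cancelʳ-≤ (lookup w i) (begin
            l + - x + x  ≡⟨ x-y+y≡x l x ⟩
            l            ≤⟨ IsLUB.least lub (below≤ 0<ε w≤ε) ⟩
            x + D        ≡⟨ +-comm x D ⟩
            D + x        ∎))
          (+-cancelʳ-≤ l (begin
            - (l + - x) + l ≡⟨ cong (_+ l) (-[x-y]≡y-x l x) ⟩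
            x + - l + l     ≡⟨ x-y+y≡x x l ⟩
            x               ≡⟨ sym (x-y+y≡x x D) ⟩
            x + - D + D     ≤⟨ +-mono-≤ (IsLUB.upper lub (isBelow i 0<ε w≤ε)) ≤-refl ⟩
            l + D           ≡⟨ +-comm l D ⟩
            D + l           ∎)))
        where
        open ≤-Reasoning
        l = proj₁ (limit i)
        lub = proj₂ (limit i)
        x = lookup w i
        D = K * (ε + ε)

    no-small-vectors : ⊥
    no-small-vectors = 0≢1 (sym (∷-injectiveˡ (N.definite (1# ∷ w*)
      (≤-antisym (≤ε*C⇒≤0 0≤C bound) (N.nonneg _)))))
      where
      U = proj₁ (norm≤coordinates (tailNorm norm))
      0≤U = proj₁ (proj₂ (norm≤coordinates (tailNorm norm)))
      -- Passing from `1# ∷ w` of norm at most ε to the limit moves each coordinate by at most 2Kε,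
      -- hence the norm by at most U · 2Kε.
      C = 1# + U * (K * (1# + 1#))
      0≤C : 0# ≤ C
      0≤C = +-nonneg 0≤1 (*-nonneg 0≤U (*-nonneg 0≤K (+-nonneg 0≤1 0≤1)))

      algebra : ∀ ε U K → ε + U * (K * (ε + ε)) ≡ ε * (1# + U * (K * (1# + 1#)))
      algebra = solve 3 (λ ε U K → ε :+ U :* (K :* (ε :+ ε)) := ε :* (con 1 :+ U :* (K :* (con 1 :+ con 1)))) refl

      bound : ∀ ε → 0# < ε → N.∥ 1# ∷ w* ∥ ≤ ε * C
      bound ε 0<ε = let w , w≤ε = small ε 0<ε in begin
        N.∥ 1# ∷ w* ∥
          ≡⟨ cong N.∥_∥ (sym (cong₂ _∷_ (+-identityʳ 1#) (v+[w-v]≡w w w*))) ⟩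
        N.∥ (1# ∷ w) +ᵛ (0# ∷ w* -ᵛ w) ∥        ≤⟨ N.triangle (1# ∷ w) (0# ∷ w* -ᵛ w) ⟩
        N.∥ 1# ∷ w ∥ + N.∥ 0# ∷ w* -ᵛ w ∥
          ≤⟨ +-mono-≤ w≤ε (proj₂ (proj₂ (norm≤coordinates (tailNorm norm))) (w* -ᵛ w) _ (w*-close 0<ε w≤ε)) ⟩
        ε + U * (K * (ε + ε))                   ≡⟨ algebra ε U K ⟩
        ε * C                                   ∎
        where open ≤-Reasoning

  abstract
    -- Induction on the dimension. Either the norm is bounded away from 0 on the vectors with head
    -- 1, which controls the first coordinate and then the others, or there are such vectors of
    -- arbitrarily small norm, which `no-small-vectors` excludes.
    coordinate≤norm : ∀ {k} (norm : Norm k) → ∃ λ K → 0# ≤ K ×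
                      ∀ v i → ∣ lookup v i ∣ ≤ K * ∥ norm ∥ v
    coordinate≤norm {zero}  norm = 0# , ≤-refl , λ _ ()
    coordinate≤norm {suc k} norm with coordinate≤norm (tailNorm norm)
    ... | K , 0≤K , tail≤ with em {∃ λ d → 0# < d × ∀ w → d ≤ ∥ norm ∥ (1# ∷ w)}
    ... | no  none = ⊥-elim (no-small-vectors norm 0≤K tail≤ small)
      where
      small : ∀ ε → 0# < ε → ∃ λ w → ∥ norm ∥ (1# ∷ w) ≤ ε
      small ε 0<ε with em {∃ λ w → ∥ norm ∥ (1# ∷ w) ≤ ε}
      ... | yes p = p
      ... | no ¬p = ⊥-elim (none (ε , 0<ε , λ w → ≰⇒≥ λ le → ¬p (w , le)))
    ... | yes (d , 0<d , below) with positive-inverse 0<d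
    -- `γ` is 1/d and bounds the first coordinate. The others are bounded by `K` times the norm of
    -- `0# ∷ w`, which is `a ∷ w` less `a` times the unit vector of norm `e`; hence the summand
    -- `K * (γ * e + 1#)`.
    ... | γ , (0≤γ , _) , dγ≡1 = γ + K * (γ * e + 1#) ,
      +-nonneg 0≤γ 0≤K[γe+1] , λ where
        (a ∷ w) zero    → ≤-trans (head≤ a w) (*-mono-≤ 0≤γ (N.nonneg _) (x≤x+y 0≤K[γe+1]) ≤-refl)
        (a ∷ w) (suc i) → begin
          ∣ lookup w i ∣                                  ≤⟨ tail≤ w i ⟩
          K * N.∥ 0# ∷ w ∥                                ≤⟨ *-monoˡ-≤ 0≤K (∥0∷v∥≤ norm a w) ⟩
          K * (∣ a ∣ * e + N.∥ a ∷ w ∥)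
            ≤⟨ *-monoˡ-≤ 0≤K (+-mono-≤ (*-mono-≤ (0≤∣x∣ a) 0≤e (head≤ a w) ≤-refl) ≤-refl) ⟩
          K * (γ * N.∥ a ∷ w ∥ * e + N.∥ a ∷ w ∥)         ≡⟨ algebra K γ (N.∥ a ∷ w ∥) e ⟩
          K * (γ * e + 1#) * N.∥ a ∷ w ∥
            ≤⟨ *-mono-≤ 0≤K[γe+1] (N.nonneg _) (x≤y+x 0≤γ) ≤-refl ⟩
          (γ + K * (γ * e + 1#)) * N.∥ a ∷ w ∥            ∎
      where
      open ≤-Reasoning
      module N = Norm norm
      e : ℝ
      e = N.∥ 1# ∷ 0ᵛ ∥
      0≤e : 0# ≤ e
      0≤e = N.nonneg (1# ∷ 0ᵛ)
      0≤K[γe+1] : 0# ≤ K * (γ * e + 1#)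
      0≤K[γe+1] = *-nonneg 0≤K (+-nonneg (*-nonneg 0≤γ 0≤e) 0≤1)

      algebra : ∀ K γ n e → K * (γ * n * e + n) ≡ K * (γ * e + 1#) * n
      algebra = solve 4 (λ K γ n e → K :* (γ :* n :* e :+ n) := K :* (γ :* e :+ con 1) :* n) refl

      head≤ : ∀ a w → ∣ a ∣ ≤ γ * N.∥ a ∷ w ∥
      head≤ a w = begin
        ∣ a ∣                 ≡⟨ sym (trans (cong (∣ a ∣ *_) dγ≡1) (*-identityʳ ∣ a ∣)) ⟩
        ∣ a ∣ * (d * γ)       ≡⟨ trans (sym (*-assoc ∣ a ∣ d γ)) (*-comm (∣ a ∣ * d) γ) ⟩
        γ * (∣ a ∣ * d)       ≤⟨ *-monoˡ-≤ 0≤γ (head-bound norm 0<d below a w) ⟩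
        γ * N.∥ a ∷ w ∥       ∎

  -- Majorants of polynomials on cubes: absolute values of coefficients, the radius for each
  -- variable.

  polyBound : ∀ {k} → Polynomial k → ℝ → ℝ
  polyBound (con a) u = ∣ a ∣
  polyBound (var i) u = u
  polyBound (q ⊕ r) u = polyBound q u + polyBound r u
  polyBound (q ⊗ r) u = polyBound q u * polyBound r u

  ∣evalPoly∣≤ : ∀ {k} (q : Polynomial k) {v u} → (∀ i → ∣ lookup v i ∣ ≤ u) →
                ∣ evalPoly q v ∣ ≤ polyBound q u
  ∣evalPoly∣≤ (con a) v≤u = ≤-refl
  ∣evalPoly∣≤ (var i) v≤u = v≤u i
  ∣evalPoly∣≤ (q ⊕ r) v≤u = ∣x+y∣≤ (∣evalPoly∣≤ q v≤u) (∣evalPoly∣≤ r v≤u)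
  ∣evalPoly∣≤ (q ⊗ r) v≤u = ∣x*y∣≤ (∣evalPoly∣≤ q v≤u) (∣evalPoly∣≤ r v≤u)

  polyBound-nonneg : ∀ {k} (q : Polynomial k) {u} → 0# ≤ u → 0# ≤ polyBound q u
  polyBound-nonneg (con a) 0≤u = 0≤∣x∣ a
  polyBound-nonneg (var i) 0≤u = 0≤u
  polyBound-nonneg (q ⊕ r) 0≤u = +-nonneg (polyBound-nonneg q 0≤u) (polyBound-nonneg r 0≤u)
  polyBound-nonneg (q ⊗ r) 0≤u = *-nonneg (polyBound-nonneg q 0≤u) (polyBound-nonneg r 0≤u)

  polyBound-mono : ∀ {k} (q : Polynomial k) {u v} → 0# ≤ u → u ≤ v → polyBound q u ≤ polyBound q v
  polyBound-mono (con a) 0≤u u≤v = ≤-refl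
  polyBound-mono (var i) 0≤u u≤v = u≤v
  polyBound-mono (q ⊕ r) 0≤u u≤v = +-mono-≤ (polyBound-mono q 0≤u u≤v) (polyBound-mono r 0≤u u≤v)
  polyBound-mono (q ⊗ r) 0≤u u≤v = *-mono-≤ (polyBound-nonneg q 0≤u)
    (polyBound-nonneg r (≤-trans 0≤u u≤v)) (polyBound-mono q 0≤u u≤v) (polyBound-mono r 0≤u u≤v)

  subexponential-polyBound : ∀ {k} (q : Polynomial k) {u} → Subexponential u →
                             Subexponential (λ b → polyBound q (u b))
  subexponential-polyBound (con a) U = subexponential-const (0≤∣x∣ a)
  subexponential-polyBound (var i) U = U
  subexponential-polyBound (q ⊕ r) U =
    subexponential-+ (subexponential-polyBound q U) (subexponential-polyBound r U)
  subexponential-polyBound (q ⊗ r) U =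
    subexponential-* (subexponential-polyBound q U) (subexponential-polyBound r U)

-- Arithmetic and suprema in [0,∞].

module Integration (em : ExcludedMiddle 0ℓ) (R : CompleteOrderedField)
  (Var : Set) (countable : Var ↣ ℕ) where

  open CompleteOrderedField R
  open OrderedField em R
  open Semiring-Solver using (solve; _:+_; _:*_; _:=_; con)
  open Theory em R Var countable
  open MeasurableSpace using (Carrier; Measurable)

  -- _≤∞_ computes, so that its arguments could not be inferred.
  infix 4 _⊑_
  record _⊑_ (x y : ℝ∞) : Set where
    constructor mk⊑
    field un⊑ : x ≤∞ y
  open _⊑_ public

  ⊑-refl : ∀ {x} → x ⊑ x
  ⊑-refl {fin r _} = mk⊑ ≤-refl
  ⊑-refl {∞}       = mk⊑ tt

  ⊑-reflexive : ∀ {x y} → x ≡ y → x ⊑ y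
  ⊑-reflexive refl = ⊑-refl

  ⊑-trans : ∀ {x y z} → x ⊑ y → y ⊑ z → x ⊑ z
  ⊑-trans {fin _ _} {fin _ _} {fin _ _} (mk⊑ p) (mk⊑ q) = mk⊑ (≤-trans p q)
  ⊑-trans {_}       {_}       {∞}       p q = mk⊑ tt
  ⊑-trans {_}       {∞}       {fin _ _} p (mk⊑ ())
  ⊑-trans {∞}       {fin _ _} {fin _ _} (mk⊑ ()) q

  fin-cong : ∀ {r s} .{p : 0# ≤ r} .{q : 0# ≤ s} → r ≡ s → fin r p ≡ fin s q
  fin-cong refl = refl

  ⊑-antisym : ∀ {x y} → x ⊑ y → y ⊑ x → x ≡ y
  ⊑-antisym {fin _ _} {fin _ _} (mk⊑ p) (mk⊑ q) = fin-cong (≤-antisym p q)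
  ⊑-antisym {fin _ _} {∞}       p (mk⊑ ())
  ⊑-antisym {∞}       {fin _ _} (mk⊑ ()) q
  ⊑-antisym {∞}       {∞}       p q = refl

  ∞-poset : Poset 0ℓ 0ℓ 0ℓ
  ∞-poset = record { isPartialOrder = record
    { isPreorder = record { isEquivalence = isEquivalence ; reflexive = ⊑-reflexive ; trans = ⊑-trans }
    ; antisym = ⊑-antisym } }

  module ⊑-Reasoning = Relation.Binary.Reasoning.PartialOrder ∞-poset

  0⊑ : ∀ {x} → 0∞ ⊑ x
  0⊑ {fin r p} = mk⊑ (recompute em p)
  0⊑ {∞}       = mk⊑ tt

  ⊑∞ : ∀ {x} → x ⊑ ∞
  ⊑∞ = mk⊑ tt

  +∞-mono : ∀ {x y u v} → x ⊑ y → u ⊑ v → x +∞ u ⊑ y +∞ v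
  +∞-mono {fin _ _} {fin _ _} {fin _ _} {fin _ _} (mk⊑ p) (mk⊑ q) = mk⊑ (+-mono-≤ p q)
  +∞-mono {_}       {fin _ _} {_}       {∞}       p q = ⊑∞
  +∞-mono {_}       {∞}       {_}       {_}       p q = ⊑∞
  +∞-mono {∞}       {fin _ _} {_}       {fin _ _} (mk⊑ ()) q
  +∞-mono {fin _ _} {fin _ _} {∞}       {fin _ _} p (mk⊑ ())

  +∞-identityˡ : ∀ x → 0∞ +∞ x ≡ x
  +∞-identityˡ (fin r _) = fin-cong (+-identityˡ r)
  +∞-identityˡ ∞         = refl

  +∞-identityʳ : ∀ x → x +∞ 0∞ ≡ x
  +∞-identityʳ (fin r _) = fin-cong (+-identityʳ r)
  +∞-identityʳ ∞         = refl

  *∞-zeroˡ : ∀ x → 0∞ *∞ x ≡ 0∞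
  *∞-zeroˡ (fin r _) = fin-cong (zeroˡ r)
  *∞-zeroˡ ∞ with em {0# ≡ 0#}
  ... | yes _   = refl
  ... | no  0≢0 = ⊥-elim (0≢0 refl)

  *∞-zeroʳ : ∀ x → x *∞ 0∞ ≡ 0∞
  *∞-zeroʳ (fin r _) = fin-cong (zeroʳ r)
  *∞-zeroʳ ∞ with em {0# ≡ 0#}
  ... | yes _   = refl
  ... | no  0≢0 = ⊥-elim (0≢0 refl)

  fin*∞≡∞ : ∀ {r} .(p : 0# ≤ r) → 0# ≢ r → fin r p *∞ ∞ ≡ ∞
  fin*∞≡∞ {r} p 0≢r with em {r ≡ 0#}
  ... | yes r≡0 = ⊥-elim (0≢r (sym r≡0))
  ... | no  _   = refl

  *∞-identityˡ : ∀ x → 1∞ *∞ x ≡ x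
  *∞-identityˡ (fin r _) = fin-cong (*-identityˡ r)
  *∞-identityˡ ∞         = fin*∞≡∞ 0≤1 0≢1

  *∞-identityʳ : ∀ x → x *∞ 1∞ ≡ x
  *∞-identityʳ (fin r _) = fin-cong (*-identityʳ r)
  *∞-identityʳ ∞ with em {1# ≡ 0#}
  ... | yes 1≡0 = ⊥-elim (0≢1 (sym 1≡0))
  ... | no  _   = refl

  -- Scaling is by positive finite constants, which fix ∞ and can be divided away again by
  -- `scale-cancel`.
  ⟨_⟩∞ : ∀ {c} → 0# < c → ℝ∞
  ⟨_⟩∞ {c} 0<c = fin c (proj₁ 0<c)

  module _ {c} (0<c : 0# < c) where
    private C = ⟨ 0<c ⟩∞

    scale∞ : C *∞ ∞ ≡ ∞
    scale∞ = fin*∞≡∞ (proj₁ 0<c) (proj₂ 0<c)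

    scale-mono : ∀ {x y} → x ⊑ y → C *∞ x ⊑ C *∞ y
    scale-mono {fin _ _} {fin _ _} (mk⊑ p)  = mk⊑ (*-monoˡ-≤ (proj₁ 0<c) p)
    scale-mono {x}       {∞}       p        = ⊑-trans ⊑∞ (⊑-reflexive (sym scale∞))
    scale-mono {∞}       {fin _ _} (mk⊑ ())

    scale-+ : ∀ x y → C *∞ (x +∞ y) ≡ C *∞ x +∞ C *∞ y
    scale-+ (fin x _) (fin y _) = fin-cong (distribˡ c x y)
    scale-+ (fin x p) ∞         = trans scale∞ (sym (cong (C *∞ fin x p +∞_) scale∞))
    scale-+ ∞         y         = trans scale∞ (sym (cong (_+∞ C *∞ y) scale∞))

    scale-assoc : ∀ r .(p : 0# ≤ r) x → (C *∞ fin r p) *∞ x ≡ C *∞ (fin r p *∞ x)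
    scale-assoc r p (fin x _) = fin-cong (*-assoc c r x)
    scale-assoc r p ∞ with em {r ≡ 0#} | em {c * r ≡ 0#}
    ... | yes _    | yes _    = fin-cong (sym (zeroʳ c))
    ... | yes refl | no cr≢0  = ⊥-elim (cr≢0 (zeroʳ c))
    ... | no  r≢0  | yes cr≡0 = ⊥-elim (proj₂ (*-pos 0<c (recompute em p , λ 0≡r → r≢0 (sym 0≡r))) (sym cr≡0))
    ... | no  _    | no _     = sym scale∞

    scale-swap : ∀ r .(p : 0# ≤ r) x → fin r p *∞ (C *∞ x) ≡ C *∞ (fin r p *∞ x)
    scale-swap r p (fin x _) = fin-cong (solve 3 (λ r c x → r :* (c :* x) := c :* (r :* x)) refl r c x)
    scale-swap r p ∞ = trans (cong (fin r p *∞_) scale∞) absorb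
      where
      absorb : fin r p *∞ ∞ ≡ C *∞ (fin r p *∞ ∞)
      absorb with em {r ≡ 0#}
      ... | yes _ = fin-cong (sym (zeroʳ c))
      ... | no  _ = sym scale∞

  scale-cancel : ∀ {c d} (0<c : 0# < c) (0<d : 0# < d) → c * d ≡ 1# → ∀ x →
                 ⟨ 0<c ⟩∞ *∞ (⟨ 0<d ⟩∞ *∞ x) ≡ x
  scale-cancel {c} {d} 0<c 0<d cd≡1 (fin x _) =
    fin-cong (trans (sym (*-assoc c d x)) (trans (cong (_* x) cd≡1) (*-identityˡ x)))
  scale-cancel 0<c 0<d cd≡1 ∞ = trans (cong (⟨ 0<c ⟩∞ *∞_) (scale∞ 0<d)) (scale∞ 0<c)

  sup-upper : ∀ (P : ℝ∞ → Set) {x} → P x → x ⊑ sup P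
  sup-upper P Px = mk⊑ (IsLUB.upper (proj₂ (supremum P)) Px)

  sup-least : ∀ (P : ℝ∞ → Set) {b} → (∀ {x} → P x → x ⊑ b) → sup P ⊑ b
  sup-least P {b} P⊑b = mk⊑ (IsLUB.least (proj₂ (supremum P)) {b} (λ Px → un⊑ (P⊑b Px)))

  ∑∞-pair : ∀ f → (∀ n → f (suc (suc n)) ≡ 0∞) → ∑∞ f ≡ f 0 +∞ f 1
  ∑∞-pair f rest≡0 = ⊑-antisym
    (sup-least Partial λ { (n , refl) → partial n })
    (⊑-trans (⊑-reflexive (cong (_+∞ f 1) (sym (+∞-identityˡ (f 0))))) (sup-upper Partial (2 , refl)))
    where
    Partial : ℝ∞ → Set
    Partial x = ∃ λ n → x ≡ (∑< n) f
    partial : ∀ n → (∑< n) f ⊑ f 0 +∞ f 1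
    partial zero             = 0⊑
    partial (suc zero)       = ⊑-trans
      (⊑-reflexive (trans (+∞-identityˡ (f 0)) (sym (+∞-identityʳ (f 0))))) (+∞-mono (⊑-refl {f 0}) (0⊑ {f 1}))
    partial (suc (suc zero)) = ⊑-reflexive (cong (_+∞ f 1) (+∞-identityˡ (f 0)))
    partial (suc (suc (suc n))) = ⊑-trans
      (⊑-reflexive (trans (cong ((∑< (suc (suc n))) f +∞_) (rest≡0 n)) (+∞-identityʳ _)))
      (partial (suc (suc n)))

  infix 4 _≐_
  -- Transfers finite values to ℝ, where cancellation and the ring solver are available.
  data _≐_ : ℝ∞ → ℝ → Set where
    fin≐ : ∀ {r} .{p : 0# ≤ r} → fin r p ≐ r

  ≐-unique : ∀ {x r s} → x ≐ r → x ≐ s → r ≡ s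
  ≐-unique fin≐ fin≐ = refl

  ≐-+ : ∀ {x y r s} → x ≐ r → y ≐ s → x +∞ y ≐ r + s
  ≐-+ fin≐ fin≐ = fin≐

  ≐-* : ∀ {x y r s} → x ≐ r → y ≐ s → x *∞ y ≐ r * s
  ≐-* fin≐ fin≐ = fin≐

  ≐-nonneg : ∀ {x r} → x ≐ r → 0# ≤ r
  ≐-nonneg (fin≐ {p = p}) = recompute em p

  toℝ : ℝ∞ → ℝ
  toℝ (fin r _) = r
  toℝ ∞         = 0#

  ≢∞⇒≐ : ∀ {x} → x ≢ ∞ → x ≐ toℝ x
  ≢∞⇒≐ {fin r _} _   = fin≐
  ≢∞⇒≐ {∞}       x≢∞ = ⊥-elim (x≢∞ refl)

  infix 4 _≤ᶠ_
  -- Finiteness together with a real bound; `r` carries no proof of nonnegativity, so that bounds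
  -- can be chained in ℝ.
  data _≤ᶠ_ : ℝ∞ → ℝ → Set where
    fin≤ : ∀ {x r} .{p : 0# ≤ x} → x ≤ r → fin x p ≤ᶠ r

  ⊑-≤ᶠ-trans : ∀ {x y r} → x ⊑ y → y ≤ᶠ r → x ≤ᶠ r
  ⊑-≤ᶠ-trans {fin _ _} (mk⊑ p) (fin≤ q) = fin≤ (≤-trans p q)
  ⊑-≤ᶠ-trans {∞}       (mk⊑ ()) (fin≤ q)

  ≤ᶠ⇒⊑ : ∀ {x r} .{p : 0# ≤ r} → x ≤ᶠ r → x ⊑ fin r p
  ≤ᶠ⇒⊑ (fin≤ q) = mk⊑ q

  ≐-≤ : ∀ {x r s} → x ≐ r → x ≤ᶠ s → r ≤ s
  ≐-≤ fin≐ (fin≤ q) = q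

  ≤-≐ : ∀ {x r s} → x ≐ r → r ≤ s → x ≤ᶠ s
  ≤-≐ fin≐ q = fin≤ q

  -- Integrals as suprema, measurable sets and finite additivity.

  module _ {M : MeasurableSpace} (μ : Measure M) (f : Carrier M → ℝ∞) where
    private
      Below : ℝ∞ → Set
      Below x = ∃ λ (s : Simple M) → (∀ a → evalSimple {M} s a ≤∞ f a) × x ≡ ∫Simple μ s

    ∫-upper : ∀ s → (∀ a → evalSimple {M} s a ⊑ f a) → ∫Simple μ s ⊑ ∫ μ f
    ∫-upper s s⊑f = sup-upper Below (s , (λ a → un⊑ (s⊑f a)) , refl)

    ∫-least : ∀ {b} → (∀ s → (∀ a → evalSimple {M} s a ⊑ f a) → ∫Simple μ s ⊑ b) → ∫ μ f ⊑ b
    ∫-least bound = sup-least Below λ { (s , s≤f , refl) → bound s (λ a → mk⊑ (s≤f a)) }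

  ∈⟦⟧ : ∀ {A : Set} (P : A → Set) {a} → P a → a ∈ ⟦ P ⟧
  ∈⟦⟧ P {a} Pa with em {P a}
  ... | yes _  = tt
  ... | no ¬Pa = ¬Pa Pa

  ⟦⟧∈ : ∀ {A : Set} (P : A → Set) {a} → a ∈ ⟦ P ⟧ → P a
  ⟦⟧∈ P {a} a∈ with em {P a}
  ... | yes Pa = Pa

  T-ext : ∀ {a b} → (T a → T b) → (T b → T a) → a ≡ b
  T-ext {false} {false} f g = refl
  T-ext {false} {true}  f g = ⊥-elim (g tt)
  T-ext {true}  {false} f g = ⊥-elim (f tt)
  T-ext {true}  {true}  f g = refl

  T-not : ∀ {b} → ¬ T b → T (not b)
  T-not {false} _  = tt
  T-not {true}  ¬t = ¬t tt

  T-not⁻ : ∀ {b} → T (not b) → ¬ T b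
  T-not⁻ {false} _ ()

  T-∧ : ∀ {a b} → T a → T b → T (a ∧ b)
  T-∧ {true} _ t = t

  T-∧ˡ : ∀ {a b} → T (a ∧ b) → T a
  T-∧ˡ {true} _ = tt

  T-∧ʳ : ∀ {a b} → T (a ∧ b) → T b
  T-∧ʳ {true} t = t

  infixr 6 _∩_
  _∩_ : ∀ {A : Set} → Subset A → Subset A → Subset A
  (B ∩ C) a = B a ∧ C a

  -- Two sets padded by ∅ to a sequence, which turns the countable axioms into finite ones.
  pair : ∀ {A : Set} → Subset A → Subset A → ℕ → Subset A
  pair B C zero          = B
  pair B C (suc zero)    = C
  pair B C (suc (suc _)) = ∅

  module _ (M : MeasurableSpace) where
    pair-measurable : ∀ {B C} → Measurable M B → Measurable M C → ∀ n → Measurable M (pair B C n)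
    pair-measurable mB mC zero          = mB
    pair-measurable mB mC (suc zero)    = mC
    pair-measurable mB mC (suc (suc _)) = MeasurableSpace.empty M

    ∩-measurable : ∀ {B C} → Measurable M B → Measurable M C → Measurable M (B ∩ C)
    ∩-measurable {B} {C} mB mC = MeasurableSpace.resp M equal
      (MeasurableSpace.compl M (MeasurableSpace.union M (pair (∁ B) (∁ C))
        (pair-measurable (MeasurableSpace.compl M mB) (MeasurableSpace.compl M mC))))
      where
      P : Carrier M → Set
      P a = ∃ λ n → a ∈ pair (∁ B) (∁ C) n
      equal : ∁ (⋃ (pair (∁ B) (∁ C))) ≗ B ∩ C
      equal a = T-ext
        (λ t → T-∧ (inB (λ t′ → T-not⁻ t (∈⟦⟧ P (0 , t′)))) (inB (λ t′ → T-not⁻ t (∈⟦⟧ P (1 , t′)))))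
        (λ t → T-not λ t′ → out t (⟦⟧∈ P t′))
        where
        inB : ∀ {b} → ¬ T (not b) → T b
        inB {false} ¬t = ¬t tt
        inB {true}  _  = tt
        out : T (B a ∧ C a) → ¬ P a
        out t (zero        , t′) = T-not⁻ t′ (T-∧ˡ t)
        out t (suc zero    , t′) = T-not⁻ t′ (T-∧ʳ {B a} t)

    whole-measurable : Measurable M whole
    whole-measurable = MeasurableSpace.compl M (MeasurableSpace.empty M)

  measure-split : ∀ {M} (μ : Measure M) {B C} → Measurable M B → Measurable M C →
                  μ ⟪ B ⟫ ≡ μ ⟪ B ∩ C ⟫ +∞ μ ⟪ B ∩ ∁ C ⟫
  measure-split {M} μ {B} {C} mB mC = trans (Measure.ext μ mB equal)
    (trans (Measure.additive μ parts parts-measurable disjoint)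
           (∑∞-pair (λ n → μ ⟪ parts n ⟫) (λ _ → Measure.null μ)))
    where
    parts = pair (B ∩ C) (B ∩ ∁ C)
    P : Carrier M → Set
    P a = ∃ λ n → a ∈ parts n

    parts-measurable = pair-measurable M (∩-measurable M mB mC)
                                         (∩-measurable M mB (MeasurableSpace.compl M mC))

    part-of : ∀ a → T (B a) → P a
    part-of a t with em {T (C a)}
    ... | yes t′ = 0 , T-∧ t t′
    ... | no  ¬t = 1 , T-∧ t (T-not ¬t)

    of-part : ∀ a → P a → T (B a)
    of-part a (zero     , t) = T-∧ˡ t
    of-part a (suc zero , t) = T-∧ˡ t

    equal : B ≗ ⋃ parts
    equal a = T-ext (λ t → ∈⟦⟧ P (part-of a t)) (λ t → of-part a (⟦⟧∈ P t))

    disjoint : ∀ {m n a} → m ≢ n → a ∈ parts m → a ∈ parts n → ⊥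
    disjoint {zero}     {zero}     m≢n s t = m≢n refl
    disjoint {zero}     {suc zero} {a} m≢n s t = T-not⁻ (T-∧ʳ {B a} t) (T-∧ʳ {B a} s)
    disjoint {suc zero} {zero}     {a} m≢n s t = T-not⁻ (T-∧ʳ {B a} s) (T-∧ʳ {B a} t)
    disjoint {suc zero} {suc zero} m≢n s t = m≢n refl

  𝟙 : ∀ {A : Set} → Subset A → A → ℝ
  𝟙 B a = if B a then 1# else 0#

  []≐𝟙 : ∀ {A : Set} (B : Subset A) a → [ B ] a ≐ 𝟙 B a
  []≐𝟙 B a with B a
  ... | true  = fin≐
  ... | false = fin≐

  -- Comparison of simple functions under a probability measure.

  module ProbabilityMeasure {M} (μ : Measure M) (mass : μ ⟪ whole ⟫ ≡ 1∞) where

    m : Subset (Carrier M) → ℝ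
    m B = toℝ (μ ⟪ B ⟫)

    -- If `B` had measure ∞, splitting `whole` along `B` would give total mass ∞.
    m≐ : ∀ {B} → Measurable M B → μ ⟪ B ⟫ ≐ m B
    m≐ {B} mB = ≢∞⇒≐ λ eq → contra (trans (sym mass)
      (trans (measure-split μ (whole-measurable M) mB) (cong (_+∞ μ ⟪ ∁ B ⟫) eq)))
      where
      contra : 1∞ ≢ ∞
      contra ()

    m-nonneg : ∀ {B} → Measurable M B → 0# ≤ m B
    m-nonneg mB = ≐-nonneg (m≐ mB)

    m-split : ∀ {B C} → Measurable M B → Measurable M C → m B ≡ m (B ∩ C) + m (B ∩ ∁ C)
    m-split {B} {C} mB mC = ≐-unique (m≐ mB) (subst (_≐ m (B ∩ C) + m (B ∩ ∁ C))
      (sym (measure-split μ mB mC))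
      (≐-+ (m≐ (∩-measurable M mB mC)) (m≐ (∩-measurable M mB (MeasurableSpace.compl M mC)))))

    m-ext : ∀ {B C} → Measurable M B → B ≗ C → m B ≡ m C
    m-ext mB B≗C = cong toℝ (Measure.ext μ mB B≗C)

    m-mono : ∀ {B C} → Measurable M B → Measurable M C → (∀ {a} → a ∈ B → a ∈ C) → m B ≤ m C
    m-mono {B} {C} mB mC B⊆C = begin
      m B
        ≡⟨ m-ext mB (λ a → T-ext (λ t → T-∧ (B⊆C t) t) (λ t → T-∧ʳ {C a} t)) ⟩
      m (C ∩ B)
        ≤⟨ x≤x+y (m-nonneg (∩-measurable M mC (MeasurableSpace.compl M mB))) ⟩
      m (C ∩ B) + m (C ∩ ∁ B)    ≡⟨ sym (m-split mC mB) ⟩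
      m C                        ∎
      where open ≤-Reasoning

    m-whole : m whole ≡ 1#
    m-whole = cong toℝ mass

    m-∩-full : ∀ {G B} → Measurable M G → Measurable M B → m G ≡ 1# → m (G ∩ B) ≡ m B
    m-∩-full {G} {B} mG mB G≡1 = sym (begin-equality
      m B                        ≡⟨ m-split mB mG ⟩
      m (B ∩ G) + m (B ∩ ∁ G)
        ≡⟨ cong₂ _+_ (m-ext (∩-measurable M mB mG) (λ a → ∧-comm (B a) (G a)))
                                      (≤-antisym null (m-nonneg (∩-measurable M mB (MeasurableSpace.compl M mG)))) ⟩
      m (G ∩ B) + 0#             ≡⟨ +-identityʳ _ ⟩
      m (G ∩ B)                  ∎)
      where
      open ≤-Reasoning
      null : m (B ∩ ∁ G) ≤ 0#
      null = +-cancelʳ-≤ 1# (begin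
        m (B ∩ ∁ G) + 1#
          ≤⟨ +-mono-≤ (m-mono (∩-measurable M mB mG′) mG′ (λ {a} t → T-∧ʳ {B a} t)) (≤-reflexive (sym G≡1)) ⟩
        m (∁ G) + m G            ≡⟨ +-comm _ _ ⟩
        m G + m (∁ G)            ≡⟨ sym (m-split (whole-measurable M) mG) ⟩
        m whole                  ≡⟨ m-whole ⟩
        1#                       ≡⟨ sym (+-identityˡ 1#) ⟩
        0# + 1#                  ∎)
        where
        mG′ = MeasurableSpace.compl M mG

    -- The counterpart of `Simple` with coefficients in ℝ; the sets may overlap here as well.
    Terms : Set
    Terms = List (ℝ × Σ (Subset (Carrier M)) (Measurable M))

    value : Terms → Carrier M → ℝ
    value []                a = 0#
    value ((c , B , _) ∷ l) a = c * 𝟙 B a + value l a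

    integral : Subset (Carrier M) → Terms → ℝ
    integral G []                = 0#
    integral G ((c , B , _) ∷ l) = c * m (G ∩ B) + integral G l

    integral-split : ∀ {G B} → Measurable M G → Measurable M B → ∀ l →
                     integral G l ≡ integral (G ∩ B) l + integral (G ∩ ∁ B) l
    integral-split mG mB [] = sym (+-identityˡ 0#)
    integral-split {G} {B} mG mB ((c , C , mC) ∷ l) = begin-equality
      c * m (G ∩ C) + integral G l
        ≡⟨ cong₂ (λ x y → c * x + y) split (integral-split mG mB l) ⟩
      c * (m ((G ∩ B) ∩ C) + m ((G ∩ ∁ B) ∩ C)) + (integral (G ∩ B) l + integral (G ∩ ∁ B) l)
        ≡⟨ algebra c (m ((G ∩ B) ∩ C)) (m ((G ∩ ∁ B) ∩ C)) (integral (G ∩ B) l) (integral (G ∩ ∁ B) l) ⟩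
      (c * m ((G ∩ B) ∩ C) + integral (G ∩ B) l) + (c * m ((G ∩ ∁ B) ∩ C) + integral (G ∩ ∁ B) l) ∎
      where
      open ≤-Reasoning
      algebra : ∀ c x y u v → c * (x + y) + (u + v) ≡ (c * x + u) + (c * y + v)
      algebra = solve 5 (λ c x y u v → c :* (x :+ y) :+ (u :+ v) := (c :* x :+ u) :+ (c :* y :+ v)) refl
      swap : ∀ x y z → (x ∧ y) ∧ z ≡ (x ∧ z) ∧ y
      swap x y z = trans (∧-assoc x y z) (trans (cong (x ∧_) (∧-comm y z)) (sym (∧-assoc x z y)))
      mB′ = MeasurableSpace.compl M mB
      split : m (G ∩ C) ≡ m ((G ∩ B) ∩ C) + m ((G ∩ ∁ B) ∩ C)
      split = trans (m-split (∩-measurable M mG mC) mB) (cong₂ _+_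
        (m-ext (∩-measurable M (∩-measurable M mG mC) mB) (λ a → swap (G a) (C a) (B a)))
        (m-ext (∩-measurable M (∩-measurable M mG mC) mB′) (λ a → swap (G a) (C a) (not (B a)))))

    𝟙-in : ∀ {B : Subset (Carrier M)} {a} → a ∈ B → 𝟙 B a ≡ 1#
    𝟙-in {B} {a} t with B a
    ... | true = refl

    𝟙-out : ∀ {B : Subset (Carrier M)} {a} → a ∈ ∁ B → 𝟙 B a ≡ 0#
    𝟙-out {B} {a} t with B a
    ... | false = refl

    value-in : ∀ c B mB l {a} e → a ∈ B → e + value ((c , B , mB) ∷ l) a ≡ (e + c) + value l a
    value-in c B mB l {a} e t = trans
      (cong (λ x → e + (x + value l a)) (trans (cong (c *_) (𝟙-in {B} t)) (*-identityʳ c)))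
      (sym (+-assoc e c (value l a)))

    value-out : ∀ c B mB l {a} e → a ∈ ∁ B → e + value ((c , B , mB) ∷ l) a ≡ e + value l a
    value-out c B mB l {a} e t = cong (e +_)
      (trans (cong (_+ value l a) (trans (cong (c *_) (𝟙-out {B} t)) (zeroʳ c))) (+-identityˡ (value l a)))

    integral-∷ : ∀ {G B} c (mG : Measurable M G) (mB : Measurable M B) l e →
      e * m G + integral G ((c , B , mB) ∷ l) ≡
      ((e + c) * m (G ∩ B) + integral (G ∩ B) l) + (e * m (G ∩ ∁ B) + integral (G ∩ ∁ B) l)
    integral-∷ {G} {B} c mG mB l e = trans
      (cong₂ (λ x y → e * x + (c * m (G ∩ B) + y)) (m-split mG mB) (integral-split mG mB l))
      (algebra e c (m (G ∩ B)) (m (G ∩ ∁ B)) (integral (G ∩ B) l) (integral (G ∩ ∁ B) l))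
      where
      algebra : ∀ e c x y u v → e * (x + y) + (c * x + (u + v)) ≡ ((e + c) * x + u) + (e * y + v)
      algebra = solve 6 (λ e c x y u v → e :* (x :+ y) :+ (c :* x :+ (u :+ v)) := ((e :+ c) :* x :+ u) :+ (e :* y :+ v)) refl

    -- G is refined until every set occurring in the terms is G or empty on it, the
    -- constants e and e′ collecting the coefficients.
    integral-mono : ∀ {G} → Measurable M G → ∀ l l′ e e′ →
      (∀ {a} → a ∈ G → e + value l a ≤ e′ + value l′ a) →
      e * m G + integral G l ≤ e′ * m G + integral G l′
    integral-mono {G} mG [] [] e e′ le with em {∃ λ a → a ∈ G}
    ... | yes (a , a∈G) = +-mono-≤ (*-mono (+-cancelʳ-≤ 0# (le a∈G))) ≤-refl
      where
      *-mono : e ≤ e′ → e * m G ≤ e′ * m G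
      *-mono e≤e′ = subst₂ _≤_ (*-comm (m G) e) (*-comm (m G) e′) (*-monoˡ-≤ (m-nonneg mG) e≤e′)
    -- On an empty `G` the pointwise hypothesis says nothing about the constants, but `m G` is 0.
    ... | no  G-empty = +-mono-≤ (≤-reflexive (trans (null e) (sym (null e′)))) ≤-refl
      where
      null : ∀ e → e * m G ≡ 0#
      null e = trans (cong (e *_) (trans (m-ext mG (λ a → T-ext (λ t → G-empty (a , t)) (λ ())))
        (cong toℝ (Measure.null μ)))) (zeroʳ e)
    integral-mono {G} mG [] ((c , B , mB) ∷ l′) e e′ le =
      subst₂ _≤_ (split-const e) (sym (integral-∷ c mG mB l′ e′)) (+-mono-≤
        (integral-mono (∩-measurable M mG mB) [] l′ e (e′ + c)
          (λ {a} t → ≤-trans (le (T-∧ˡ t)) (≤-reflexive (value-in c B mB l′ e′ (T-∧ʳ {G a} t)))))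
        (integral-mono (∩-measurable M mG (MeasurableSpace.compl M mB)) [] l′ e e′
          (λ {a} t → ≤-trans (le (T-∧ˡ t)) (≤-reflexive (value-out c B mB l′ e′ (T-∧ʳ {G a} t))))))
      where
      algebra : ∀ e x y → (e * x + 0#) + (e * y + 0#) ≡ e * (x + y) + 0#
      algebra = solve 3 (λ e x y → (e :* x :+ con 0) :+ (e :* y :+ con 0) := e :* (x :+ y) :+ con 0) refl
      split-const : ∀ e → (e * m (G ∩ B) + 0#) + (e * m (G ∩ ∁ B) + 0#) ≡ e * m G + 0#
      split-const e = trans (algebra e (m (G ∩ B)) (m (G ∩ ∁ B))) (cong (λ x → e * x + 0#) (sym (m-split mG mB)))
    integral-mono {G} mG ((c , B , mB) ∷ l) l′ e e′ le =
      subst₂ _≤_ (sym (integral-∷ c mG mB l e)) merge (+-mono-≤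
        (integral-mono (∩-measurable M mG mB) l l′ (e + c) e′
          (λ {a} t → ≤-trans (≤-reflexive (sym (value-in c B mB l e (T-∧ʳ {G a} t)))) (le (T-∧ˡ t))))
        (integral-mono (∩-measurable M mG (MeasurableSpace.compl M mB)) l l′ e e′
          (λ {a} t → ≤-trans (≤-reflexive (sym (value-out c B mB l e (T-∧ʳ {G a} t)))) (le (T-∧ˡ t)))))
      where
      algebra : ∀ e x y u v → (e * x + u) + (e * y + v) ≡ e * (x + y) + (u + v)
      algebra = solve 5 (λ e x y u v → (e :* x :+ u) :+ (e :* y :+ v) := e :* (x :+ y) :+ (u :+ v)) refl
      merge : (e′ * m (G ∩ B) + integral (G ∩ B) l′) + (e′ * m (G ∩ ∁ B) + integral (G ∩ ∁ B) l′) ≡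
              e′ * m G + integral G l′
      merge = trans (algebra e′ (m (G ∩ B)) (m (G ∩ ∁ B)) (integral (G ∩ B) l′) (integral (G ∩ ∁ B) l′))
        (cong₂ (λ x y → e′ * x + y) (sym (m-split mG mB)) (sym (integral-split mG mB l′)))

    integral-full : ∀ {G} → Measurable M G → m G ≡ 1# → ∀ l → integral G l ≡ integral whole l
    integral-full mG G≡1 []                 = refl
    integral-full mG G≡1 ((c , B , mB) ∷ l) =
      cong₂ (λ x y → c * x + y) (m-∩-full mG mB G≡1) (integral-full mG G≡1 l)

    terms : Simple M → Terms
    terms []                      = []
    terms (((c , _) , B , mB) ∷ s) = (toℝ c , B , mB) ∷ terms s

    evalSimple≐ : ∀ s a → evalSimple {M} s a ≐ value (terms s) a
    evalSimple≐ []                            a = fin≐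
    evalSimple≐ (((c , c≢∞) , B , mB) ∷ s) a =
      ≐-+ (≐-* (≢∞⇒≐ c≢∞) ([]≐𝟙 B a)) (evalSimple≐ s a)

    ∫Simple≐ : ∀ s → ∫Simple μ s ≐ integral whole (terms s)
    ∫Simple≐ []                          = fin≐
    ∫Simple≐ (((c , c≢∞) , B , mB) ∷ s) = ≐-+ (≐-* (≢∞⇒≐ c≢∞) (m≐ mB)) (∫Simple≐ s)

    -- Restricting both integrals to a set `G` of full measure changes neither, so an almost sure
    -- comparison is as good as one everywhere. On `G` it is `integral-mono` with both constants 0.
    ∫Simple≤ : ∀ {G} → Measurable M G → m G ≡ 1# → ∀ l s →
               (∀ {a} → a ∈ G → evalSimple {M} s a ≤ᶠ value l a) →
               ∀ {ε} .{0≤ε : 0# ≤ ε} → integral whole l ≤ ε → ∫Simple μ s ⊑ fin ε 0≤ε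
    ∫Simple≤ {G} mG G≡1 l s s≤l {ε} {0≤ε} I≤ε = ≤ᶠ⇒⊑ (≤-≐ (∫Simple≐ s) (begin
      integral whole (terms s)             ≡⟨ sym (integral-full mG G≡1 (terms s)) ⟩
      integral G (terms s)                 ≡⟨ sym (drop (integral G (terms s))) ⟩
      0# * m G + integral G (terms s)      ≤⟨ integral-mono mG (terms s) l 0# 0# (λ {a} a∈G →
                                                +-mono-≤ ≤-refl (≐-≤ (evalSimple≐ s a) (s≤l a∈G))) ⟩
      0# * m G + integral G l              ≡⟨ drop (integral G l) ⟩
      integral G l                         ≡⟨ integral-full mG G≡1 l ⟩
      integral whole l                     ≤⟨ I≤ε ⟩
      ε                                    ∎))
      where
      open ≤-Reasoning
      drop : ∀ x → 0# * m G + x ≡ x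
      drop x = trans (cong (_+ x) (zeroˡ (m G))) (+-identityˡ x)

  -- Homogeneity of the integral.

  module _ {M : MeasurableSpace} {c} (0<c : 0# < c) where
    private C = ⟨ 0<c ⟩∞

    scaleSimple : Simple M → Simple M
    scaleSimple []                        = []
    scaleSimple (((fin r p , _) , B) ∷ s) = ((C *∞ fin r p , λ ()) , B) ∷ scaleSimple s
    scaleSimple (((∞ , ∞≢∞) , _) ∷ s)     = ⊥-elim (∞≢∞ refl)

    evalSimple-scale : ∀ s a → evalSimple {M} (scaleSimple s) a ≡ C *∞ evalSimple {M} s a
    evalSimple-scale []                              a = sym (*∞-zeroʳ C)
    evalSimple-scale (((fin r p , _) , B , _) ∷ s) a = trans
      (cong₂ _+∞_ (scale-assoc 0<c r p ([ B ] a)) (evalSimple-scale s a))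
      (sym (scale-+ 0<c (fin r p *∞ [ B ] a) (evalSimple {M} s a)))
    evalSimple-scale (((∞ , ∞≢∞) , _) ∷ s)          a = ⊥-elim (∞≢∞ refl)

    ∫Simple-scale : ∀ (μ : Measure M) s → ∫Simple μ (scaleSimple s) ≡ C *∞ ∫Simple μ s
    ∫Simple-scale μ []                            = sym (*∞-zeroʳ C)
    ∫Simple-scale μ (((fin r p , _) , B , _) ∷ s) = trans
      (cong₂ _+∞_ (scale-assoc 0<c r p (μ ⟪ B ⟫)) (∫Simple-scale μ s))
      (sym (scale-+ 0<c (fin r p *∞ μ ⟪ B ⟫) (∫Simple μ s)))
    ∫Simple-scale μ (((∞ , ∞≢∞) , _) ∷ s)         = ⊥-elim (∞≢∞ refl)

  -- A simple function below `f`, divided by `c`, lies below `g`; this compares the two suprema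
  -- directly, for arbitrary `f` and `g`.
  ∫-scale : ∀ {M} (μ : Measure M) {c} (0<c : 0# < c) f g →
            (∀ a → f a ⊑ ⟨ 0<c ⟩∞ *∞ g a) → ∫ μ f ⊑ ⟨ 0<c ⟩∞ *∞ ∫ μ g
  ∫-scale {M} μ {c} 0<c f g f⊑cg with positive-inverse 0<c
  ... | d , 0<d , cd≡1 = ∫-least μ f λ s s⊑f → begin
    ∫Simple μ s
      ≡⟨ sym (scale-cancel 0<c 0<d cd≡1 (∫Simple μ s)) ⟩
    ⟨ 0<c ⟩∞ *∞ (⟨ 0<d ⟩∞ *∞ ∫Simple μ s)
      ≡⟨ cong (⟨ 0<c ⟩∞ *∞_) (sym (∫Simple-scale {M} 0<d μ s)) ⟩
    ⟨ 0<c ⟩∞ *∞ ∫Simple μ (scaleSimple {M} 0<d s)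
      ≤⟨ scale-mono 0<c (∫-upper μ g (scaleSimple {M} 0<d s) (scaled s s⊑f)) ⟩
    ⟨ 0<c ⟩∞ *∞ ∫ μ g                                  ∎
    where
    open ⊑-Reasoning
    scaled : ∀ s → (∀ a → evalSimple {M} s a ⊑ f a) → ∀ a → evalSimple {M} (scaleSimple {M} 0<d s) a ⊑ g a
    scaled s s⊑f a = begin
      evalSimple {M} (scaleSimple {M} 0<d s) a    ≡⟨ evalSimple-scale {M} 0<d s a ⟩
      ⟨ 0<d ⟩∞ *∞ evalSimple {M} s a          ≤⟨ scale-mono 0<d (⊑-trans (s⊑f a) (f⊑cg a)) ⟩
      ⟨ 0<d ⟩∞ *∞ (⟨ 0<c ⟩∞ *∞ g a)
        ≡⟨ scale-cancel 0<d 0<c (trans (*-comm d c) cd≡1) (g a) ⟩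
      g a                                     ∎

-- Looping time and the stopped process.

module LoopChain (em : ExcludedMiddle 0ℓ) (R : CompleteOrderedField)
  (Var : Set) (countable : Var ↣ ℕ) where

  open CompleteOrderedField R
  open OrderedField em R
  open Theory em R Var countable
  open MeasurableSpace using (Carrier; Measurable)
  open Norms em R Var countable
  open Integration em R Var countable
  open Predicate using (set)
  open Trace using (X)

  -- Shows that a looping time of `nothing` really means that the trace never exits. The bound `b`
  -- decreases with each smaller witness and makes the recursion terminate.
  least-witness : ∀ (P : ℕ → Set) b n → n ℕ.≤ b → P n → ∃ λ l → P l × (∀ m → P m → l ℕ.≤ m)
  least-witness P b n n≤b Pn with em {∃ λ m → m ℕ.< n × P m}
  ... | no  none = n , Pn , λ m Pm → ℕₚ.≮⇒≥ λ m<n → none (m , m<n , Pm)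
  least-witness P zero    zero n≤b Pn | yes (m , () , Pm)
  least-witness P (suc b) n    n≤b Pn | yes (m , m<n , Pm) =
    least-witness P b m (ℕ.s≤s⁻¹ (ℕₚ.≤-trans m<n n≤b)) Pm

  module _ (φ : Predicate) where

    Continues : Trace → ℕ → Set
    Continues s i = ¬ X s i ⊨¬ φ

    continues-before-just : ∀ {s t i} → loopingTime φ s ≡ just t → i ℕ.< t → Continues s i
    continues-before-just {s} eq i<t exit
      with em {∃ λ n → X s n ⊨¬ φ × (∀ m → X s m ⊨¬ φ → n ℕ.≤ m)}
    continues-before-just refl i<t exit | yes (_ , _ , least) = ℕₚ.<⇒≱ i<t (least _ exit)

    continues-nothing : ∀ {s i} → loopingTime φ s ≡ nothing → Continues s i
    continues-nothing {s} {i} eq exit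
      with em {∃ λ n → X s n ⊨¬ φ × (∀ m → X s m ⊨¬ φ → n ℕ.≤ m)}
    ... | no none = none (least-witness (λ n → X s n ⊨¬ φ) i i ℕₚ.≤-refl exit)

    exceeds⇒continues : ∀ {s N i} → loopingTime φ s >ᵀ N → i ℕ.< suc N → Continues s i
    exceeds⇒continues {s} T>N i<1+N with loopingTime φ s in eq
    ... | just t  = continues-before-just eq (ℕₚ.≤-trans i<1+N T>N)
    ... | nothing = continues-nothing eq

    continues⇒exceeds : ∀ {s N} → (∀ i → i ℕ.< suc N → Continues s i) → loopingTime φ s >ᵀ N
    continues⇒exceeds {s} {N} continues
      with em {∃ λ n → X s n ⊨¬ φ × (∀ m → X s m ⊨¬ φ → n ℕ.≤ m)}
    ... | yes (t , exit , _) = ℕₚ.≰⇒> λ t≤N → continues t (ℕ.s≤s t≤N) exit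
    ... | no  _              = tt

    -- The time `t` is min(n, T).
    stopped-at : ∀ n s → ∃ λ t → t ℕ.≤ n × stopped φ n s ≡ X s t × (∀ i → i ℕ.< t → Continues s i)
    stopped-at n s with loopingTime φ s in eq
    ... | nothing = n , ℕₚ.≤-refl , refl , λ i _ → continues-nothing eq
    ... | just t with n ≤ᵇ t in n≤ᵇt
    ... | true  = n , ℕₚ.≤-refl , refl , λ i i<n → continues-before-just eq
                    (ℕₚ.≤-trans i<n (ℕₚ.≤ᵇ⇒≤ n t (subst T (sym n≤ᵇt) tt)))
    ... | false = t , ℕₚ.<⇒≤ (ℕₚ.≰⇒> λ n≤t → subst T n≤ᵇt (ℕₚ.≤⇒≤ᵇ n≤t)) , refl ,
                    λ i i<t → continues-before-just eq i<t

    -- ⊥ satisfies no predicate, so that the looping time counts it as unstopped.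
    unstopped : Subset State⊥
    unstopped (just σ) = set φ σ
    unstopped nothing  = true

    -- Without ⊥ the probability of visits to this set is 0 from the sink, so that the bound `p` for
    -- one block holds from every point of `State⊥`.
    guarded : Subset State⊥
    guarded (just σ) = set φ σ
    guarded nothing  = false

    ∈unstopped⇒ : ∀ x → x ∈ unstopped → ¬ x ⊨¬ φ
    ∈unstopped⇒ (just σ) t exit = T-not⁻ exit t
    ∈unstopped⇒ nothing  t ()

    ⇒∈unstopped : ∀ x → ¬ x ⊨¬ φ → x ∈ unstopped
    ⇒∈unstopped nothing  _ = tt
    ⇒∈unstopped (just σ) continues with set φ σ
    ... | true  = tt
    ... | false = continues tt

    guarded⊆unstopped : ∀ x → x ∈ guarded → x ∈ unstopped
    guarded⊆unstopped (just σ) t = t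

    ⇒∈guarded : ∀ x → x ≢ nothing → ¬ x ⊨¬ φ → x ∈ guarded
    ⇒∈guarded nothing  x≢⊥ _ = x≢⊥ refl
    ⇒∈guarded (just σ) _   c = ⇒∈unstopped (just σ) c

    unstopped-measurable : Measurable States⊥ unstopped
    unstopped-measurable = Predicate.measurable φ

    guarded-measurable : Measurable States⊥ guarded
    guarded-measurable = Predicate.measurable φ

  -- Cylinders of repeated visits.

  cylinder-measurable : ∀ n {Bs} → All (Measurable States⊥) Bs → Measurable Traces (cylinder n Bs)
  cylinder-measurable n []          = whole-measurable Traces
  cylinder-measurable n (_∷_ {x = B} {xs = Bs} mB mBs) = ∩-measurable Traces
    (basic (n , B , mB , λ _ → refl)) (cylinder-measurable (suc n) mBs)

  ⇒∈cylinder : ∀ B s j n → (∀ i → i ℕ.< j → X s (n ℕ.+ i) ∈ B) → s ∈ cylinder n (replicate j B)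
  ⇒∈cylinder B s zero    n visit = tt
  ⇒∈cylinder B s (suc j) n visit = T-∧
    (subst (λ m → X s m ∈ B) (ℕₚ.+-identityʳ n) (visit 0 (ℕ.s≤s ℕ.z≤n)))
    (⇒∈cylinder B s j (suc n) λ i i<j → subst (λ m → X s m ∈ B) (ℕₚ.+-suc n i) (visit (suc i) (ℕ.s≤s i<j)))

  ∈cylinder⇒ : ∀ B s j n → s ∈ cylinder n (replicate j B) → ∀ i → i ℕ.< j → X s (n ℕ.+ i) ∈ B
  ∈cylinder⇒ B s (suc j) n t zero    _     =
    subst (λ m → X s m ∈ B) (sym (ℕₚ.+-identityʳ n)) (T-∧ˡ t)
  ∈cylinder⇒ B s (suc j) n t (suc i) i<j =
    subst (λ m → X s m ∈ B) (sym (ℕₚ.+-suc n i)) (∈cylinder⇒ B s j (suc n) (T-∧ʳ {B (X s n)} t) i (ℕ.s≤s⁻¹ i<j))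

  -- Geometric decay of repeated visits.

  module _ (μ : State → Measure States) where

    1∸-finite : ∀ x → ∃ λ r → Σ (0# ≤ r) λ 0≤r → 1∸ x ≡ fin r 0≤r
    1∸-finite ∞ = 0# , ≤-refl , refl
    1∸-finite (fin r _) with em {r ≤ 1#}
    ... | yes r≤1 = _ , x≤y⇒0≤y-x r≤1 , refl
    ... | no  _   = 0# , ≤-refl , refl

    -- The weight of the sink is first replaced by a finite `r`, because `scale-swap` moves `c` past
    -- finite factors.
    step-scale : ∀ {c} (0<c : 0# < c) f g → (∀ x → f x ⊑ ⟨ 0<c ⟩∞ *∞ g x) →
                 ∀ x → step μ f x ⊑ ⟨ 0<c ⟩∞ *∞ step μ g x
    step-scale 0<c f g f⊑cg nothing  = f⊑cg nothing
    step-scale 0<c f g f⊑cg (just τ) with 1∸ (μ τ ⟪ whole ⟫) | 1∸-finite (μ τ ⟪ whole ⟫)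
    ... | _ | r , 0≤r , refl = begin
      ∫ (μ τ) f′ +∞ fin r 0≤r *∞ f nothing
        ≤⟨ +∞-mono (∫-scale (μ τ) 0<c f′ g′ (λ σ → f⊑cg (just σ))) (fin*-mono r 0≤r (f⊑cg nothing)) ⟩
      C *∞ ∫ (μ τ) g′ +∞ fin r 0≤r *∞ (C *∞ g nothing)
        ≡⟨ cong (C *∞ ∫ (μ τ) g′ +∞_) (scale-swap 0<c r 0≤r (g nothing)) ⟩
      C *∞ ∫ (μ τ) g′ +∞ C *∞ (fin r 0≤r *∞ g nothing)
        ≡⟨ sym (scale-+ 0<c (∫ (μ τ) g′) (fin r 0≤r *∞ g nothing)) ⟩
      C *∞ (∫ (μ τ) g′ +∞ fin r 0≤r *∞ g nothing) ∎
      where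
      open ⊑-Reasoning
      C = ⟨ 0<c ⟩∞
      f′ g′ : State → ℝ∞
      f′ σ = f (just σ)
      g′ σ = g (just σ)
      fin*-mono : ∀ r (0≤r : 0# ≤ r) {x y} → x ⊑ y → fin r 0≤r *∞ x ⊑ fin r 0≤r *∞ y
      fin*-mono r 0≤r {x} {y} x⊑y with em {0# ≡ r}
      ... | yes refl = ⊑-trans (⊑-reflexive (*∞-zeroˡ x)) 0⊑
      ... | no  0≢r  = scale-mono (0≤r , 0≢r) x⊑y

    -- The Markov property as an inequality: whatever state is reached after the `j` visits, the
    -- remaining visits have probability at most `c`, and this constant is pulled out through each
    -- `step`.
    visits-++ : ∀ {c} (0<c : 0# < c) {B L} → (∀ x → visits μ L x ⊑ ⟨ 0<c ⟩∞) → ∀ j x →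
                visits μ (replicate j B ++ L) x ⊑ ⟨ 0<c ⟩∞ *∞ visits μ (replicate j B) x
    visits-++ 0<c L⊑c zero    x = ⊑-trans (L⊑c x) (⊑-reflexive (sym (*∞-identityʳ _)))
    visits-++ 0<c {B} {L} L⊑c (suc j) x with B x
    ... | false = ⊑-trans (⊑-reflexive (*∞-zeroˡ (step μ (visits μ (replicate j B ++ L)) x))) 0⊑
    ... | true  = begin
      1∞ *∞ step μ f x          ≡⟨ *∞-identityˡ (step μ f x) ⟩
      step μ f x                ≤⟨ step-scale 0<c f g (visits-++ 0<c L⊑c j) x ⟩
      C *∞ step μ g x           ≡⟨ cong (C *∞_) (sym (*∞-identityˡ (step μ g x))) ⟩
      C *∞ (1∞ *∞ step μ g x)   ∎
      where
      open ⊑-Reasoning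
      C = ⟨ 0<c ⟩∞
      f = visits μ (replicate j B ++ L)
      g = visits μ (replicate j B)

    replicate-+ : ∀ {A : Set} m n {x : A} → replicate (m ℕ.+ n) x ≡ replicate m x ++ replicate n x
    replicate-+ zero    n = refl
    replicate-+ (suc m) n = cong (_ ∷_) (replicate-+ m n)

    ^-pos : ∀ {p} → 0# < p → ∀ b → 0# < p ^ b
    ^-pos 0<p zero    = 0≤1 , 0≢1
    ^-pos 0<p (suc b) = *-pos 0<p (^-pos 0<p b)

    visits-geometric : ∀ {p} (0<p : 0# < p) M {B} → (∀ x → visits μ (replicate M B) x ⊑ ⟨ 0<p ⟩∞) →
                       ∀ b x → visits μ (replicate (b ℕ.* M) B) x ⊑ ⟨ ^-pos 0<p b ⟩∞
    visits-geometric 0<p M bound zero    x = ⊑-refl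
    visits-geometric {p} 0<p M {B} bound (suc b) x = begin
      visits μ (replicate (M ℕ.+ b ℕ.* M) B) x
        ≡⟨ cong (λ L → visits μ L x) (replicate-+ M (b ℕ.* M)) ⟩
      visits μ (replicate M B ++ replicate (b ℕ.* M) B) x
        ≤⟨ visits-++ (^-pos 0<p b) (visits-geometric 0<p M bound b) M x ⟩
      ⟨ ^-pos 0<p b ⟩∞ *∞ visits μ (replicate M B) x
        ≤⟨ scale-mono (^-pos 0<p b) (bound x) ⟩
      ⟨ ^-pos 0<p b ⟩∞ *∞ ⟨ 0<p ⟩∞                            ≡⟨ fin-cong (*-comm (p ^ b) p) ⟩
      ⟨ ^-pos 0<p (suc b) ⟩∞                                  ∎
      where open ⊑-Reasoning

    module _ (ℙ : State → Measure Traces) (law : IsChainLaw μ ℙ) where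

      ℙ-mass : ∀ σ → ℙ σ ⟪ whole ⟫ ≡ 1∞
      ℙ-mass σ = law σ [] []

      -- The event T > N constrains the N + 1 times 0, ..., N, which fixes the block length `suc N`.
      -- From ⊥ the first visit to `guarded φ` already fails.
      guarded-visits : ∀ φ {N p} (0<p : 0# < p) →
        (∀ σ → ℙ σ ⟪ ⟦ (λ s → loopingTime φ s >ᵀ N) ⟧ ⟫ ≤∞ ⟨ 0<p ⟩∞) →
        ∀ x → visits μ (replicate (suc N) (guarded φ)) x ⊑ ⟨ 0<p ⟩∞
      guarded-visits φ {N} 0<p exceeds≤p nothing  =
        ⊑-trans (⊑-reflexive (*∞-zeroˡ (step μ (visits μ (replicate N (guarded φ))) nothing))) 0⊑
      guarded-visits φ {N} 0<p exceeds≤p (just σ) = begin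
        visits μ (replicate (suc N) (guarded φ)) (just σ)     ≡⟨ sym (law σ _ allGuarded) ⟩
        ℙ σ ⟪ Guarded ⟫                                       ≤⟨ Guarded⊑Exceeds ⟩
        ℙ σ ⟪ Exceeds ⟫                                       ≤⟨ mk⊑ (exceeds≤p σ) ⟩
        ⟨ 0<p ⟩∞                                              ∎
        where
        open ⊑-Reasoning
        open ProbabilityMeasure (ℙ σ) (ℙ-mass σ)
        Guarded = cylinder 0 (replicate (suc N) (guarded φ))
        Exceeding : Trace → Set
        Exceeding s = loopingTime φ s >ᵀ N
        Exceeds = ⟦ Exceeding ⟧
        allGuarded = replicate⁺ (suc N) (guarded-measurable φ)

        Guarded-measurable : Measurable Traces Guarded
        Guarded-measurable = cylinder-measurable 0 allGuarded

        -- The values of a measure carry meaning on measurable sets only, so the event T > N is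
        -- identified with a cylinder. Its sets are `unstopped φ`, as a trace that falls into ⊥ does
        -- not exit.
        Exceeds-measurable : Measurable Traces Exceeds
        Exceeds-measurable = MeasurableSpace.resp Traces
          (λ s → T-ext
            (λ t → ∈⟦⟧ Exceeding (continues⇒exceeds φ {s} λ i i≤N → ∈unstopped⇒ φ (X s i) (∈cylinder⇒ (unstopped φ) s (suc N) 0 t i i≤N)))
            (λ t → ⇒∈cylinder (unstopped φ) s (suc N) 0 λ i i≤N → ⇒∈unstopped φ (X s i) (exceeds⇒continues φ {s} (⟦⟧∈ Exceeding t) i≤N)))
          (cylinder-measurable 0 (replicate⁺ (suc N) (unstopped-measurable φ)))

        Guarded⊆Exceeds : ∀ {s} → s ∈ Guarded → s ∈ Exceeds
        Guarded⊆Exceeds {s} t = ∈⟦⟧ Exceeding (continues⇒exceeds φ {s} λ i i≤N →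
          ∈unstopped⇒ φ (X s i) (guarded⊆unstopped φ (X s i) (∈cylinder⇒ (guarded φ) s (suc N) 0 t i i≤N)))

        ≐-mono : ∀ {x y r s} → x ≐ r → y ≐ s → r ≤ s → x ⊑ y
        ≐-mono fin≐ fin≐ r≤s = mk⊑ r≤s

        Guarded⊑Exceeds : ℙ σ ⟪ Guarded ⟫ ⊑ ℙ σ ⟪ Exceeds ⟫
        Guarded⊑Exceeds = ≐-mono (m≐ Guarded-measurable) (m≐ Exceeds-measurable)
          (m-mono Guarded-measurable Exceeds-measurable Guarded⊆Exceeds)

  -- Uniform integrability through simple functions.

  -- The integrand of UniformlyIntegrable involves a relation local to Defs, so that
  -- it has to be found by unification.
  tailCondition : ∀ {M} (μ : Measure M) Y → ∃ λ (A : ℝ → ℕ → Simple M → Carrier M → Set) →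
    UniformlyIntegrable μ Y ≡
    (∀ ε (0<ε : 0# < ε) → ∃ λ r₀ → ∀ r → r₀ ≤ r →
      sup (λ x → ∃ λ n → x ≡ sup (λ y → ∃ λ s → (∀ a → A r n s a) × y ≡ ∫Simple μ s))
        ≤∞ fin ε (proj₁ 0<ε))
  tailCondition μ Y = _ , refl

  tail-cases : ∀ {M} (μ : Measure M) Y r n s a {y} → proj₁ (tailCondition μ Y) r n s a → Y n a ≐ y →
               evalSimple {M} s a ⊑ 0∞ ⊎ (r ≤ y × evalSimple {M} s a ⊑ Y n a)
  tail-cases μ Y r n s a s≤Y Y≐y with Y n a
  -- This is the instance of excluded middle on which the Iverson bracket in the integrand is stuck;
  -- deciding it turns the bracket into 1 or 0.
  tail-cases μ Y r n s a s≤Y (fin≐ {y} {p}) | _ with em {r ≤ y}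
  ... | yes r≤y = inj₂ (r≤y , ⊑-trans (mk⊑ s≤Y) (⊑-reflexive (*∞-identityʳ (fin y p))))
  ... | no  _   = inj₁ (⊑-trans (mk⊑ s≤Y) (⊑-reflexive (*∞-zeroʳ (fin y p))))

  uniformlyIntegrable : ∀ {M} (μ : Measure M) Y →
    (∀ ε (0<ε : 0# < ε) → ∃ λ r₀ → ∀ r → r₀ ≤ r → ∀ n s →
      (∀ a {y} → Y n a ≐ y → evalSimple {M} s a ⊑ 0∞ ⊎ (r ≤ y × evalSimple {M} s a ⊑ Y n a)) →
      ∫Simple μ s ⊑ fin ε (proj₁ 0<ε)) →
    UniformlyIntegrable μ Y
  uniformlyIntegrable {M} μ Y bound ε 0<ε with bound ε 0<ε
  ... | r₀ , bound′ = r₀ , λ r r₀≤r → un⊑ {y = fin ε (proj₁ 0<ε)} (sup-least _ λ { (n , refl) →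
    sup-least _ λ { (s , s≤Y , refl) → bound′ r r₀≤r n s λ a → tail-cases μ Y r n s a (s≤Y a) } })

  -- Boxes and linear growth along traces.

  -c≤x⇒-x≤c : ∀ {x c} → - c ≤ x → - x ≤ c
  -c≤x⇒-x≤c {x} {c} le = +-cancelʳ-≤ x (begin
    - x + x    ≡⟨ trans (-‿inverseˡ x) (sym (-‿inverseʳ c)) ⟩
    c + - c    ≤⟨ +-mono-≤ ≤-refl le ⟩
    c + x      ∎)
    where open ≤-Reasoning

  upper-bound : ∀ {k} (f : Fin k → ℝ) → ∃ λ u → 0# ≤ u × ∀ i → ∣ f i ∣ ≤ u
  upper-bound {zero}  f = 0# , ≤-refl , λ ()
  upper-bound {suc k} f with upper-bound (λ i → f (suc i))
  ... | u , 0≤u , f≤u = ∣ f zero ∣ + u , +-nonneg (0≤∣x∣ (f zero)) 0≤u , λ where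
    zero    → x≤x+y 0≤u
    (suc i) → ≤-trans (f≤u i) (x≤y+x (0≤∣x∣ (f zero)))

  ⋂ : ∀ {A : Set} {k} → (Fin k → Subset A) → Subset A
  ⋂ {k = zero}  S = whole
  ⋂ {k = suc k} S = S zero ∩ ⋂ (λ i → S (suc i))

  ⋂-measurable : ∀ M {k} (S : Fin k → Subset (Carrier M)) → (∀ i → Measurable M (S i)) → Measurable M (⋂ S)
  ⋂-measurable M {zero}  S mS = whole-measurable M
  ⋂-measurable M {suc k} S mS = ∩-measurable M (mS zero) (⋂-measurable M (λ i → S (suc i)) (λ i → mS (suc i)))

  ∈⋂ : ∀ {A : Set} {k} (S : Fin k → Subset A) {a} → (∀ i → a ∈ S i) → a ∈ ⋂ S
  ∈⋂ {k = zero}  S a∈ = tt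
  ∈⋂ {k = suc k} S a∈ = T-∧ (a∈ zero) (∈⋂ (λ i → S (suc i)) (λ i → a∈ (suc i)))

  ⋂∈ : ∀ {A : Set} {k} (S : Fin k → Subset A) {a} → a ∈ ⋂ S → ∀ i → a ∈ S i
  ⋂∈ {k = suc k} S     a∈ zero    = T-∧ˡ a∈
  ⋂∈ {k = suc k} S {a} a∈ (suc i) = ⋂∈ (λ i → S (suc i)) (T-∧ʳ {S zero a} a∈) i

  module _ {k} (vars : Fin k ↣ Var) where
    open Injection vars using (to)

    AtMost : Var → ℝ → Subset State
    AtMost x a σ = ⟦ _≤ a ⟧ (σ x)

    AtMost-measurable : ∀ x a → Measurable States (AtMost x a)
    AtMost-measurable x a = basic (x , ⟦ _≤ a ⟧ , basic (a , λ _ → refl) , λ _ → refl)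

    -- Half-open intervals, as the Borel sets are generated by the rays { x ≤ a }.
    Box : ℝ → Subset State⊥
    Box u nothing  = false
    Box u (just σ) = ⋂ (λ i → AtMost (to i) u ∩ ∁ (AtMost (to i) (- (u + 1#)))) σ

    Box-measurable : ∀ u → Measurable States⊥ (Box u)
    Box-measurable u = ⋂-measurable States (λ i → AtMost (to i) u ∩ ∁ (AtMost (to i) (- (u + 1#)))) λ i →
      ∩-measurable States (AtMost-measurable (to i) u) (compl (AtMost-measurable (to i) (- (u + 1#))))

    -- The slack 1 keeps the state off the excluded lower end: a coordinate at most -(u + 1) would
    -- give u + 1 ≤ u.
    ∈Box : ∀ {u} σ → (∀ i → ∣ σ (to i) ∣ ≤ u) → just σ ∈ Box u
    ∈Box {u} σ σ≤u = ∈⋂ (λ i → AtMost (to i) u ∩ ∁ (AtMost (to i) (- (u + 1#)))) λ i →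
      T-∧ (∈⟦⟧ (_≤ u) (≤-trans (x≤∣x∣ _) (σ≤u i)))
          (T-not λ t → x<x+1 (≤-trans (≤-reflexive (sym (-‿involutive (u + 1#))))
            (-c≤u (⟦⟧∈ (_≤ - (u + 1#)) t) (σ≤u i))))
      where
      -c≤u : ∀ {x c u} → x ≤ c → ∣ x ∣ ≤ u → - c ≤ u
      -c≤u {x} {c} {u} x≤c ∣x∣≤u = -c≤x⇒-x≤c (≤-trans
        (-c≤x⇒-x≤c (≤-trans (-x≤∣x∣ x) ∣x∣≤u)) x≤c)

    Within : ℝ → State⊥ → Set
    Within u (just σ) = ∀ i → ∣ σ (to i) ∣ ≤ u
    Within u nothing  = ⊥

    Within-mono : ∀ {u v} → u ≤ v → ∀ x → Within u x → Within v x
    Within-mono u≤v (just σ) σ≤u i = ≤-trans (σ≤u i) u≤v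

    Within⇒just : ∀ {u} x → Within u x → x ≢ nothing
    Within⇒just (just σ) _ ()

    Box⇒Within : ∀ {u} → 0# ≤ u → ∀ x → x ∈ Box u → Within (u + 1#) x
    Box⇒Within {u} 0≤u (just σ) σ∈Box i = ∣x∣≤
      (≤-trans (⟦⟧∈ (_≤ u) (T-∧ˡ in-i)) (x≤x+y 0≤1))
      (-c≤x⇒-x≤c (≰⇒≥ λ le → T-not⁻ (T-∧ʳ {AtMost (to i) u σ} in-i) (∈⟦⟧ (_≤ - (u + 1#)) le)))
      where
      in-i : σ ∈ (AtMost (to i) u ∩ ∁ (AtMost (to i) (- (u + 1#))))
      in-i = ⋂∈ (λ i → AtMost (to i) u ∩ ∁ (AtMost (to i) (- (u + 1#)))) σ∈Box i

    Within-step : ∀ norm {K c} → 0# ≤ K → (∀ v i → ∣ lookup v i ∣ ≤ K * Norm.∥_∥ norm v) →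
      ∀ {u} x y → Within u x → UpdateWithin vars norm c x y → Within (u + K * c) y
    Within-step norm {K} {c} 0≤K coordinate≤ {u} (just σ) (just τ) σ≤u τ-σ≤c i = begin
      ∣ τ (to i) ∣
        ≡⟨ cong ∣_∣ (sym (x+[y-x]≡y (σ (to i)) (τ (to i)))) ⟩
      ∣ σ (to i) + (τ (to i) + - σ (to i)) ∣         ≤⟨ ∣x+y∣≤ (σ≤u i) update ⟩
      u + K * c                                      ∎
      where
      open ≤-Reasoning
      update : ∣ τ (to i) + - σ (to i) ∣ ≤ K * c
      update = begin
        ∣ τ (to i) + - σ (to i) ∣
          ≡⟨ cong₂ (λ x y → ∣ x + - y ∣) (sym (lookup∘tabulate _ i)) (sym (lookup∘tabulate _ i)) ⟩
        ∣ lookup (vector vars τ) i + - lookup (vector vars σ) i ∣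
          ≡⟨ cong ∣_∣ (sym (lookup-zipWith (λ x y → x + - y) i (vector vars τ) (vector vars σ))) ⟩
        ∣ lookup (vector vars τ -ᵛ vector vars σ) i ∣          ≤⟨ coordinate≤ _ i ⟩
        K * Norm.∥_∥ norm (vector vars τ -ᵛ vector vars σ)     ≤⟨ *-monoˡ-≤ 0≤K τ-σ≤c ⟩
        K * c                                                  ∎

    abstract
      ∃-polynomial-bound : ∀ h → PolynomiallyBounded vars h →
        ∃ λ (r : Polynomial k) → ∀ {u} x → Within u x → atState⊥ h x ≤ᶠ polyBound r u
      ∃-polynomial-bound h (q , (r , q≡r) , h⪯q) = r , bound
        where
        bound : ∀ {u} x → Within u x → atState⊥ h x ≤ᶠ polyBound r u
        bound {u} (just σ) σ≤u = ⊑-≤ᶠ-trans (mk⊑ (h⪯q σ)) (subst (_≤ᶠ polyBound r u) (sym (proj₂ (q≡r σ)))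
          (fin≤ (≤-trans (x≤∣x∣ _) (∣evalPoly∣≤ r (λ i →
            ≤-trans (≤-reflexive (cong ∣_∣ (lookup∘tabulate (λ i → σ (to i)) i))) (σ≤u i))))))

    module _ (μ : State → Measure States) (ℙ : State → Measure Traces) (law : IsChainLaw μ ℙ) where

      -- Once the indicator of `B` is 1, the formula for the cylinder agrees with the one for
      -- `whole`, whose cylinder contains all traces and has mass 1.
      startsIn : ∀ B σ → Measurable States⊥ B → just σ ∈ B → ℙ σ ⟪ cylinder 0 (B ∷ []) ⟫ ≡ 1∞
      startsIn B σ mB σ∈B = trans (law σ (B ∷ []) (mB ∷ []))
        (trans (cong (_*∞ step μ (visits μ []) (just σ)) (indicator σ∈B))
          (trans (sym (law σ (whole ∷ []) (_∷_ {x = whole} (whole-measurable States⊥) []))) (ℙ-mass μ ℙ law σ)))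
        where
        indicator : just σ ∈ B → [ B ] (just σ) ≡ 1∞
        indicator t with B (just σ)
        ... | true = refl

      abstract
        -- The law of the chain fixes the initial state only up to null sets. The start is therefore
        -- caught in the measurable `Box u`, which has full measure, and the updates add at most K ·
        -- c per step to each coordinate.
        linear-growth : ∀ norm → BoundedUpdate vars norm ℙ → ∃ λ L → 0# ≤ L × ∀ σ →
          ∃ λ u → 0# ≤ u × AlmostSurely (ℙ σ) (λ s → ∀ t → Within (u + t · L) (X s t))
        linear-growth norm (c , 0≤c , updates) with coordinate≤norm norm
        ... | K , 0≤K , coordinate≤ = K * c , *-nonneg 0≤K 0≤c , start
          where
          start : ∀ σ → ∃ λ u → 0# ≤ u × AlmostSurely (ℙ σ) (λ s → ∀ t → Within (u + t · (K * c)) (X s t))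
          start σ with upper-bound (λ i → σ (to i)) | updates σ
          ... | u , 0≤u , σ≤u | G , mG , ℙG≡1 , bounded =
            -- The 1 is the width added to the box at its lower end.
            u + 1# , +-nonneg 0≤u 0≤1 , G ∩ Start , ∩-measurable Traces mG mStart , full , λ {s} t →
              within s (T-∧ʳ {G s} t) (bounded (T-∧ˡ t))
            where
            open ProbabilityMeasure (ℙ σ) (ℙ-mass μ ℙ law σ)
            Start : Subset Trace
            Start = cylinder 0 (Box u ∷ [])

            mStart : Measurable Traces Start
            mStart = cylinder-measurable 0 {Box u ∷ []} (Box-measurable u ∷ [])

            full : ℙ σ ⟪ G ∩ Start ⟫ ≡ 1∞
            full = ≐⇒≡ (m≐ (∩-measurable Traces mG mStart)) (trans (m-∩-full mG mStart (cong toℝ ℙG≡1))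
              (cong toℝ (startsIn (Box u) σ (Box-measurable u) (∈Box σ σ≤u))))
              where
              ≐⇒≡ : ∀ {x r} → x ≐ r → r ≡ 1# → x ≡ 1∞
              ≐⇒≡ fin≐ refl = refl

            within : ∀ s → s ∈ Start → (∀ n → UpdateWithin vars norm c (X s n) (X s (suc n))) →
                     ∀ t → Within (u + 1# + t · (K * c)) (X s t)
            within s s∈Start step≤c zero = Within-mono (≤-reflexive (sym (+-identityʳ (u + 1#)))) (X s 0)
              (Box⇒Within 0≤u (X s 0) (T-∧ˡ s∈Start))
            within s s∈Start step≤c (suc t) = Within-mono (≤-reflexive (trans (+-assoc (u + 1#) (t · (K * c)) (K * c))
                (cong (u + 1# +_) (+-comm (t · (K * c)) (K * c))))) (X s (suc t))
              (Within-step norm 0≤K coordinate≤ (X s t) (X s (suc t)) (within s s∈Start step≤c t) (step≤c t))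

      -- The dominating sum of indicators.

      module Domination (φ : Predicate) {N p} (0<p : 0# < p)
        (exceeds≤p : ∀ σ → ℙ σ ⟪ ⟦ (λ s → loopingTime φ s >ᵀ N) ⟧ ⟫ ≤∞ ⟨ 0<p ⟩∞)
        (σ : State) (w : ℕ → ℝ) (0≤w : ∀ b → 0# ≤ w b) where

        open ProbabilityMeasure (ℙ σ) (ℙ-mass μ ℙ law σ)

        Unstopped : ℕ → Subset Trace
        Unstopped b = cylinder 0 (replicate (b ℕ.* suc N) (guarded φ))

        allGuarded : ∀ b → All (Measurable States⊥) (replicate (b ℕ.* suc N) (guarded φ))
        allGuarded b = replicate⁺ (b ℕ.* suc N) (guarded-measurable φ)

        Unstopped-measurable : ∀ b → Measurable Traces (Unstopped b)
        Unstopped-measurable b = cylinder-measurable 0 (allGuarded b)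

        m-Unstopped≤ : ∀ b → m (Unstopped b) ≤ p ^ b
        m-Unstopped≤ b = ≐-≤ (m≐ (Unstopped-measurable b)) (⊑-≤ᶠ-trans
          (⊑-trans (⊑-reflexive (law σ _ (allGuarded b)))
            (visits-geometric μ 0<p (suc N) (guarded-visits μ ℙ law φ 0<p exceeds≤p) b (just σ)))
          (fin≤ ≤-refl))

        -- The events are nested, so the terms overlap. For a trace stopped in block j the j-th term
        -- alone is large enough, and the others are nonnegative.
        dominating : ℕ → ℕ → Terms
        dominating b zero    = []
        dominating b (suc n) = (w b , Unstopped b , Unstopped-measurable b) ∷ dominating (suc b) n

        integral-dominating : ∀ b n → integral whole (dominating b n) ≤ sumFrom (λ b → w b * p ^ b) b n
        integral-dominating b zero    = ≤-refl
        integral-dominating b (suc n) =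
          +-mono-≤ (*-monoˡ-≤ (0≤w b) (m-Unstopped≤ b)) (integral-dominating (suc b) n)

        0≤𝟙 : ∀ (B : Subset Trace) s → 0# ≤ 𝟙 B s
        0≤𝟙 B s with B s
        ... | true  = 0≤1
        ... | false = ≤-refl

        0≤value : ∀ b n s → 0# ≤ value (dominating b n) s
        0≤value b zero    s = ≤-refl
        0≤value b (suc n) s = +-nonneg (*-nonneg (0≤w b) (0≤𝟙 (Unstopped b) s)) (0≤value (suc b) n s)

        w≤value : ∀ {s} b n j → b ℕ.≤ j → j ℕ.< b ℕ.+ n → s ∈ Unstopped j → w j ≤ value (dominating b n) s
        w≤value b zero    j b≤j j<b+0 _ = ⊥-elim (ℕₚ.<⇒≱ j<b+0 (subst (ℕ._≤ j) (sym (ℕₚ.+-identityʳ b)) b≤j))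
        w≤value {s} b (suc n) j b≤j j<b+1+n s∈ with ℕₚ.m≤n⇒m<n∨m≡n b≤j
        ... | inj₁ b<j  = ≤-trans (w≤value (suc b) n j b<j (subst (j ℕ.<_) (ℕₚ.+-suc b n) j<b+1+n) s∈)
                                  (x≤y+x (*-nonneg (0≤w b) (0≤𝟙 (Unstopped b) s)))
        ... | inj₂ refl = ≤-trans
          (≤-reflexive (sym (trans (cong (w b *_) (𝟙-in {Unstopped b} s∈)) (*-identityʳ (w b)))))
          (x≤x+y (0≤value (suc b) n s))

      -- The tail estimate for the stopped process.

      uniformlyIntegrableFor : ∀ norm φ {N p} (0<p : 0# < p) → p < 1# →
        (∀ σ → ℙ σ ⟪ ⟦ (λ s → loopingTime φ s >ᵀ N) ⟧ ⟫ ≤∞ ⟨ 0<p ⟩∞) →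
        ∀ h → BoundedUpdate vars norm ℙ → PolynomiallyBounded vars h → UniformlyIntegrableFor ℙ φ h
      uniformlyIntegrableFor norm φ {N} {p} 0<p@(0≤p , _) (p≤1 , p≢1) exceeds≤p h bounded polynomial σ
        with linear-growth norm bounded | ∃-polynomial-bound h polynomial
      ... | L , 0≤L , growth | r , h≤r with growth σ
      ... | u , 0≤u , G , mG , ℙG≡1 , within = uniformlyIntegrable (ℙ σ) Y λ ε 0<ε →
        let J , tail≤ε = subexponential-tail w-subexponential ratio 0<ε in
        -- On `G`, values of `h` up to time JM are at most the first summand, so a value above the
        -- threshold belongs to a later time, in block `J` or beyond. The `suc n` blocks from `J` on
        -- include block t/M, since t ≤ n.
        polyBound r (reach (J ℕ.* M)) + 1# , λ ρ r₀≤ρ n s s≤Y →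
          ∫Simple≤ mG (cong toℝ ℙG≡1) (dominating J (suc n)) s
            (λ {a} a∈G → pointwise ρ r₀≤ρ n s a a∈G (s≤Y a))
            (≤-trans (integral-dominating J (suc n)) (tail≤ε (suc n)))
        where
        M = suc N

        Y : ℕ → Trace → ℝ∞
        Y n s = atState⊥ h (stopped φ n s)

        reach : ℕ → ℝ
        reach t = u + t · L

        0≤reach : ∀ t → 0# ≤ reach t
        0≤reach t = +-nonneg 0≤u (·-nonneg t 0≤L)

        -- The reach at time (b + 1)M, the end of block `b`, arranged so that its growth in `b` is
        -- visibly linear.
        blockReach : ℕ → ℝ
        blockReach b = u + (M · L + b · (M · L))

        reach≤blockReach : ∀ t b → t ℕ.≤ suc b ℕ.* M → reach t ≤ blockReach b
        reach≤blockReach t b t≤ = +-mono-≤ ≤-refl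
          (≤-trans (·-monoˡ-≤ 0≤L t≤) (≤-reflexive (sym (×-assocˡ L (suc b) M))))

        w : ℕ → ℝ
        w b = polyBound r (blockReach b)

        w-subexponential : Subexponential w
        w-subexponential = subexponential-polyBound r
          (subexponential-+ (subexponential-const 0≤u)
            (subexponential-+ (subexponential-const 0≤ML) (subexponential-linear 0≤ML)))
          where
          0≤ML : 0# ≤ M · L
          0≤ML = ·-nonneg M 0≤L

        ratio : Ratio p (1# + - p)
        ratio = 0≤p , (x≤y⇒0≤y-x p≤1 , λ 0≡1-p → p≢1 (trans (sym (+-identityʳ p))
          (trans (cong (p +_) 0≡1-p) (x+[y-x]≡y p 1#)))) , x+[y-x]≡y p 1#

        open Domination φ 0<p exceeds≤p σ w (Subexponential.nonneg w-subexponential)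
        open ProbabilityMeasure (ℙ σ) (ℙ-mass μ ℙ law σ)

        pointwise : ∀ {J} ρ → polyBound r (reach (J ℕ.* M)) + 1# ≤ ρ → ∀ n s a → a ∈ G →
          (∀ {y} → Y n a ≐ y → evalSimple {Traces} s a ⊑ 0∞ ⊎ (ρ ≤ y × evalSimple {Traces} s a ⊑ Y n a)) →
          evalSimple {Traces} s a ≤ᶠ value (dominating J (suc n)) a
        pointwise {J} ρ r₀≤ρ n s a a∈G s≤Y = conclude (s≤Y (proj₂ (≤ᶠ⇒≐ Y≤)))
          where
          t = proj₁ (stopped-at φ n a)
          t≤n = proj₁ (proj₂ (stopped-at φ n a))
          stopped≡ = proj₁ (proj₂ (proj₂ (stopped-at φ n a)))
          continues = proj₂ (proj₂ (proj₂ (stopped-at φ n a)))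

          Y≤ : Y n a ≤ᶠ polyBound r (reach t)
          Y≤ = subst (λ x → atState⊥ h x ≤ᶠ polyBound r (reach t)) (sym stopped≡) (h≤r (X a t) (within a∈G t))

          ≤ᶠ⇒≐ : ∀ {x r} → x ≤ᶠ r → ∃ λ y → x ≐ y
          ≤ᶠ⇒≐ (fin≤ {x} _) = x , fin≐

          conclude : evalSimple {Traces} s a ⊑ 0∞ ⊎ (ρ ≤ proj₁ (≤ᶠ⇒≐ Y≤) × evalSimple {Traces} s a ⊑ Y n a) →
                     evalSimple {Traces} s a ≤ᶠ value (dominating J (suc n)) a
          conclude (inj₁ s≤0) = ⊑-≤ᶠ-trans s≤0 (fin≤ (0≤value J (suc n) a))
          conclude (inj₂ (ρ≤y , s⊑Y)) = ⊑-≤ᶠ-trans s⊑Y (≤ᶠ-≤-trans Y≤ (begin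
            polyBound r (reach t)
              ≤⟨ polyBound-mono r (0≤reach t) (reach≤blockReach t (t ℕ./ M) t≤block) ⟩
            w (t ℕ./ M)
              -- At all times before (t/M)M ≤ t the loop has not exited, and `within` keeps the
              -- trace out of ⊥. The trace thus passes t/M full blocks inside `guarded φ`.
              ≤⟨ w≤value J (suc n) (t ℕ./ M) J≤t/M t/M<J+1+n (⇒∈cylinder (guarded φ) a (t ℕ./ M ℕ.* M) 0
                                                     λ i i< → ⇒∈guarded φ (X a i) (Within⇒just (X a i) (within a∈G i))
                                                       (continues i (ℕₚ.≤-trans i< (ℕ.m/n*n≤m t M)))) ⟩
            value (dominating J (suc n)) a      ∎))
            where
            open ≤-Reasoning
            ≤ᶠ-≤-trans : ∀ {x r r′} → x ≤ᶠ r → r ≤ r′ → x ≤ᶠ r′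
            ≤ᶠ-≤-trans (fin≤ p) q = fin≤ (≤-trans p q)

            t≤block : t ℕ.≤ suc (t ℕ./ M) ℕ.* M
            t≤block = subst (ℕ._≤ suc (t ℕ./ M) ℕ.* M) (sym (ℕ.m≡m%n+[m/n]*n t M))
              (ℕₚ.+-monoˡ-≤ (t ℕ./ M ℕ.* M) (ℕₚ.<⇒≤ (ℕ.m%n<n t M)))

            JM≤t : J ℕ.* M ℕ.≤ t
            -- Here the extra 1 in the threshold is spent: an earlier `t` would give x + 1 ≤ x for
            -- the bound x at time JM.
            JM≤t = ℕₚ.≮⇒≥ λ t<JM → x<x+1 (begin
              polyBound r (reach (J ℕ.* M)) + 1#  ≤⟨ r₀≤ρ ⟩
              ρ                                   ≤⟨ ρ≤y ⟩
              proj₁ (≤ᶠ⇒≐ Y≤)                     ≤⟨ ≐-≤ (proj₂ (≤ᶠ⇒≐ Y≤)) Y≤ ⟩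
              polyBound r (reach t)
                ≤⟨ polyBound-mono r (0≤reach t) (+-mono-≤ ≤-refl (·-monoˡ-≤ 0≤L (ℕₚ.<⇒≤ t<JM))) ⟩
              polyBound r (reach (J ℕ.* M))       ∎)

            J≤t/M : J ℕ.≤ t ℕ./ M
            J≤t/M = subst (ℕ._≤ t ℕ./ M) (ℕ.m*n/n≡m J M) (ℕ./-monoˡ-≤ M JM≤t)

            t/M<J+1+n : t ℕ./ M ℕ.< J ℕ.+ suc n
            t/M<J+1+n = ℕₚ.≤-trans (ℕ.s≤s (ℕₚ.≤-trans (ℕ.m/n≤m t M) t≤n)) (ℕₚ.m≤n+m (suc n) J)

theorem18 :
  (em : ExcludedMiddle 0ℓ) (R : CompleteOrderedField)
  (Var : Set) (countable : Var ↣ ℕ) →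
  let open CompleteOrderedField R
      open Theory em R Var countable
  in
  {k : ℕ} (vars : Fin k ↣ Var) (norm : Norm k)
  (φ : Predicate) (C : Program) → OnlyListed vars (while φ C) →
  (μ : State → Measure States) → IsFinalStateMeasure C μ →
  (ℙ : State → Measure Traces) → IsChainLaw μ ℙ →
  (∃ λ (N : ℕ) → ∃ λ (p : ℝ) → Σ (0# < p) λ 0<p → p < 1# ×
    (∀ σ → ℙ σ ⟪ ⟦ (λ s → loopingTime φ s >ᵀ N) ⟧ ⟫ ≤∞ fin p (proj₁ 0<p))) →
  (h : 𝔼) → (∀ σ → 𝔼.fun h σ ≢ ∞) →
  BoundedUpdate vars norm ℙ →
  PolynomiallyBounded vars h →
  UniformlyIntegrableFor ℙ φ h
theorem18 em R Var countable vars norm φ C _ μ _ ℙ law (N , p , 0<p , p<1 , exceeds≤p) h _ =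
  LoopChain.uniformlyIntegrableFor em R Var countable vars μ ℙ law norm φ 0<p p<1 exceeds≤p h
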